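{- $\mathsf{SRT}^2_2 \not\le_{\rm sc} \mathsf{SPT}^2_2$. That is, there is a stable 2-coloring of pairs $f$ such that for every stable 2-coloring of pairs $\widehat{f}$ computable from $f$ there is a set $\widehat{H}$ which is p-homogeneous for $\widehat{f}$ and which computes no set homogeneous for $f$.
   Context: A 2-coloring of pairs is a function $f:[\omega]^2\to 2$, where $[S]^2$ is the set of 2-element subsets of $S$; write $f(x,y)$ for $f(\{x,y\})$ with $x<y$. It is stable if $\lim_u f(x,u)$ exists for every $x\in\omega$. An infinite set $H\subseteq\omega$ is homogeneous for $f$ if $f$ is constant on $[H]^2$. A set $H=H_L\oplus H_R$ (with $H_L,H_R$ infinite) is p-homogeneous for $f$ if $f$ is constant on $\{\{x,y\}: x\in H_L, y\in H_R, x\neq y\}$. $\mathsf{SRT}^2_2$ is the problem whose instances are stable 2-colorings of pairs and whose solutions are homogeneous sets; $\mathsf{SPT}^2_2$ is the problem with the same instances whose solutions are p-homogeneous sets. For problems $\mathsf P,\mathsf Q$, $\mathsf P\le_{\rm sc}\mathsf Q$ (strong computable reducibility) means: every instance $X$ of $\mathsf P$ computes an instance $\widehat X$ of $\mathsf Q$ such that every solution $\widehat Y$ of $\widehat X$ computes a solution of $X$. -}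

module Defs where

open import Data.Nat using (ℕ; zero; suc; _≤_; _<_; _<ᵇ_)
open import Data.Fin using (Fin)
open import Data.Vec using (Vec; []; _∷_; lookup)
open import Data.Bool using (Bool; true; false; if_then_else_)
open import Data.Product using (Σ; _×_; ∃)
open import Relation.Binary.PropositionalEquality using (_≡_; _≢_)
open import Relation.Nullary using (¬_)

-- Oracle computation: partial recursive functions relative to an oracle.
-- An oracle is a (total) binary function ℕ → ℕ → ℕ; the primitive `orc`
-- queries it.  (A binary oracle lets sets and colorings of pairs be used
-- directly as oracles without a pairing function.)

Oracle : Set
Oracle = ℕ → ℕ → ℕ

data PR : ℕ → Set where
  Z    : ∀ {n} → PR n
  S    : PR 1
  P    : ∀ {n} → Fin n → PR n
  orc  : PR 2
  comp : ∀ {m n} → PR m → Vec (PR n) m → PR n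
  prec : ∀ {n} → PR n → PR (suc (suc n)) → PR (suc n)
  mu   : ∀ {n} → PR (suc n) → PR n

mutual
  data Eval (X : Oracle) : ∀ {n} → PR n → Vec ℕ n → ℕ → Set where
    eZ    : ∀ {n} {xs : Vec ℕ n} → Eval X Z xs 0
    eS    : ∀ {x} → Eval X S (x ∷ []) (suc x)
    eP    : ∀ {n} {i : Fin n} {xs} → Eval X (P i) xs (lookup xs i)
    eorc  : ∀ {x y} → Eval X orc (x ∷ y ∷ []) (X x y)
    ecomp : ∀ {m n} {g : PR m} {hs : Vec (PR n) m} {xs : Vec ℕ n} {zs : Vec ℕ m} {y} →
            EvalAll X hs xs zs → Eval X g zs y → Eval X (comp g hs) xs y
    eprec0 : ∀ {n} {g : PR n} {h} {xs : Vec ℕ n} {y} →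
             Eval X g xs y → Eval X (prec g h) (0 ∷ xs) y
    eprecS : ∀ {n} {g : PR n} {h} {xs : Vec ℕ n} {k z y} →
             Eval X (prec g h) (k ∷ xs) z → Eval X h (k ∷ z ∷ xs) y →
             Eval X (prec g h) (suc k ∷ xs) y
    emu   : ∀ {n} {g : PR (suc n)} {xs : Vec ℕ n} {k} →
            Eval X g (k ∷ xs) 0 →
            (∀ j → j < k → Σ ℕ (λ m → Eval X g (j ∷ xs) (suc m))) →
            Eval X (mu g) xs k

  data EvalAll (X : Oracle) {n : ℕ} : ∀ {m} → Vec (PR n) m → Vec ℕ n → Vec ℕ m → Set where
    [] : ∀ {xs} → EvalAll X [] xs []
    _∷_ : ∀ {m} {h : PR n} {hs : Vec (PR n) m} {xs z zs} →
          Eval X h xs z → EvalAll X hs xs zs → EvalAll X (h ∷ hs) xs (z ∷ zs)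

bit : Bool → ℕ
bit true  = 1
bit false = 0

Subset : Set
Subset = ℕ → Bool

-- A 2-coloring of pairs: f x y is the colour of {x,y} for x < y
-- (values with x ≥ y are irrelevant).
Coloring : Set
Coloring = ℕ → ℕ → Bool

col : Coloring → ℕ → ℕ → Bool
col f x y = if x <ᵇ y then f x y else f y x

setOracle : Subset → Oracle
setOracle A x _ = bit (A x)

colOracle : Coloring → Oracle
colOracle f x y = bit (f x y)

ComputesSet : Oracle → Subset → Set
ComputesSet X A = Σ (PR 1) λ e → ∀ x → Eval X e (x ∷ []) (bit (A x))

ComputesColoring : Oracle → Coloring → Set
ComputesColoring X g = Σ (PR 2) λ e → ∀ x y → Eval X e (x ∷ y ∷ []) (bit (g x y))

Infinite : Subset → Set
Infinite A = ∀ n → Σ ℕ λ m → n ≤ m × A m ≡ true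

Stable : Coloring → Set
Stable f = ∀ x → Σ Bool λ c → Σ ℕ λ N → ∀ u → N ≤ u → x < u → f x u ≡ c

Homogeneous : Coloring → Subset → Set
Homogeneous f H = Infinite H × Σ Bool λ c →
  ∀ x y → x < y → H x ≡ true → H y ≡ true → f x y ≡ c

-- H = H_L ⊕ H_R with H_L(n) = H(2n), H_R(n) = H(2n+1).
left : Subset → Subset
left H n = H (n Data.Nat.* 2)

right : Subset → Subset
right H n = H (suc (n Data.Nat.* 2))

PHomogeneous : Coloring → Subset → Set
PHomogeneous f H = Infinite (left H) × Infinite (right H) × Σ Bool λ c →
  ∀ x y → x ≢ y → left H x ≡ true → right H y ≡ true → col f x y ≡ c

{-# OPTIONS --safe #-}
module Submission where

-- f is generic for finite conditions that fix f on an initial segment of ω together with the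
-- limits there.  Given a functional e with Φ_e(f) stable, a p-homogeneous set is built from finite
-- approximations F: an element y may be added to F once a condition decides the limit of
-- Φ_e(f)(y, ·).  Call F big for x if some tree of extensions of F, infinitely branching at every
-- node, puts x into Ψ.  Bigness does not mention conditions, so if F is big for an x whose limit
-- under f is still free, that limit can be chosen first and F extended to output x afterwards.
-- If Ψ can never be made to fail, then the elements y that make F big for x_y have their colour
-- determined by the limit of x_y.  Hence one can pretend that x_y has the wrong limit while the
-- rest of F is stabilised, choose u with x_u so large that f(x_y, x_u) has the wrong value, and
-- then restore the limit of x_y: both x_y and x_u are output, yet lie in no common homogeneous set.
-- This needs y and u to be on the same side of L ⊕ R, which the two sides cannot both prevent.

open import Defs
open import Level using (0ℓ)
open import Axiom.ExcludedMiddle using (ExcludedMiddle)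
open import Data.Bool using (Bool; true; false; not; T)
import Data.Bool as Bool
open import Data.Bool.Properties using (¬-not)
open import Data.Empty using (⊥; ⊥-elim)
open import Data.Fin as Fin using ()
open import Data.Fin.Properties using (fromℕ<-toℕ; toℕ<n)
open import Data.List using (List; []; _∷_)
open import Data.List.Membership.Propositional using (_∈_)
open import Data.List.Relation.Unary.Any using (here; there)
open import Data.Nat using (ℕ; zero; suc; _+_; _*_; _⊔_; _≤_; _<_; z≤n; s≤s; _<?_; _≤?_; _≟_; _<ᵇ_)
open import Data.Nat.Properties hiding (_<?_; _≤?_; _≟_)
open import Data.Product using (Σ; _×_; _,_; proj₁; proj₂)
open import Data.Sum using (_⊎_; inj₁; inj₂)
open import Data.Unit using (⊤; tt)
open import Data.Vec using (Vec; []; _∷_)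
open import Relation.Binary using (tri<; tri≈; tri>)
open import Relation.Binary.PropositionalEquality
open import Relation.Nullary using (¬_; Dec; yes; no; does)

-- Oracle computations

-- Forcing a value of Φ_e(f) depends only on the values of f fixed so far, whereas deciding a limit
-- of Φ_e(f) depends on the promised limits as well. So if one promised limit is reversed, all
-- forced pairs survive and only decisions are lost; they must be made again with the same colour.
-- This is why every element y needs a number x_y that controls its colour in both directions:
-- unavoidability yields one direction only, that colour i for y requires the right limit at x_y.
-- The other direction has two sources. If, on some reservoir and below some condition, one colour
-- can never be decided, then it is automatic. Otherwise both colours can be decided densely; if
-- each of them has a functional that cannot be avoided, the two functionals give numbers for the
-- same y, and since limits are free these numbers must coincide. Hence one of the two colours
-- always works, although it is not known in advance which one.

bit-injective : ∀ {a b} → bit a ≡ bit b → a ≡ b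
bit-injective {false} {false} _ = refl
bit-injective {true}  {true}  _ = refl

eval-det : ∀ {X n} {e : PR n} {xs v w} → Eval X e xs v → Eval X e xs w → v ≡ w
evalAll-det : ∀ {X n m} {es : Vec (PR n) m} {xs vs ws} →
              EvalAll X es xs vs → EvalAll X es xs ws → vs ≡ ws
eval-det eZ eZ = refl
eval-det eS eS = refl
eval-det eP eP = refl
eval-det eorc eorc = refl
eval-det (ecomp as a) (ecomp bs b) with refl ← evalAll-det as bs = eval-det a b
eval-det (eprec0 a) (eprec0 b) = eval-det a b
eval-det (eprecS a a′) (eprecS b b′) with refl ← eval-det a b = eval-det a′ b′
eval-det (emu {k = k} a f) (emu {k = k′} b g) with <-cmp k k′
... | tri≈ _ eq _ = eq
... | tri< k<k′ _ _ with () ← eval-det a (proj₂ (g k k<k′))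
... | tri> _ _ k′<k with () ← eval-det b (proj₂ (f k′ k′<k))
evalAll-det [] [] = refl
evalAll-det (a ∷ as) (b ∷ bs) = cong₂ _∷_ (eval-det a b) (evalAll-det as bs)

Agree : ℕ → Oracle → Oracle → Set
Agree b X Y = ∀ x y → x < b → y < b → X x y ≡ Y x y

Agree-≤ : ∀ {a b X Y} → a ≤ b → Agree b X Y → Agree a X Y
Agree-≤ a≤b ag x y x< y< = ag x y (<-≤-trans x< a≤b) (<-≤-trans y< a≤b)

Local : Oracle → (Oracle → Set) → Set
Local X Q = Σ ℕ λ b → ∀ Y → Agree b X Y → Q Y

local-map₂ : ∀ {X P Q R} → (∀ {Y} → P Y → Q Y → R Y) → Local X P → Local X Q → Local X R
local-map₂ h (a , f) (b , g) = a ⊔ b , λ Y ag →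
  h (f Y (Agree-≤ (m≤m⊔n a b) ag)) (g Y (Agree-≤ (m≤n⊔m a b) ag))

local-below : ∀ {X} k {Q : ℕ → Oracle → Set} → (∀ j → j < k → Local X (Q j)) →
              Local X (λ Y → ∀ j → j < k → Q j Y)
local-below zero f = 0 , λ _ _ _ ()
local-below (suc k) f =
  local-map₂ (λ below at j j<sk → split below at j (m≤n⇒m<n∨m≡n (≤-pred j<sk)))
    (local-below k (λ j j<k → f j (m<n⇒m<1+n j<k))) (f k ≤-refl)
  where
  split : ∀ {Q : ℕ → Set} → (∀ j → j < k → Q j) → Q k → ∀ j → j < k ⊎ j ≡ k → Q j
  split below at j (inj₁ j<k) = below j j<k
  split below at .k (inj₂ refl) = at

-- The use principle: a halting computation asks finitely many questions, and the bound exceeds both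
-- arguments of each of them.
eval-local : ∀ {X n} {e : PR n} {xs v} → Eval X e xs v → Local X (λ Y → Eval Y e xs v)
evalAll-local : ∀ {X n m} {es : Vec (PR n) m} {xs vs} →
                EvalAll X es xs vs → Local X (λ Y → EvalAll Y es xs vs)
eval-local eZ = 0 , λ _ _ → eZ
eval-local eS = 0 , λ _ _ → eS
eval-local eP = 0 , λ _ _ → eP
eval-local {X} (eorc {x} {y}) = suc (x ⊔ y) , λ Y ag →
  subst (Eval Y orc (x ∷ y ∷ [])) (sym (ag x y (s≤s (m≤m⊔n x y)) (s≤s (m≤n⊔m x y)))) eorc
eval-local (ecomp as a) = local-map₂ ecomp (evalAll-local as) (eval-local a)
eval-local (eprec0 a) with b , f ← eval-local a = b , λ Y ag → eprec0 (f Y ag)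
eval-local (eprecS a b) = local-map₂ eprecS (eval-local a) (eval-local b)
eval-local (emu {k = k} a f) = local-map₂ emu (eval-local a) (local-below k below)
  where
  below : ∀ j → j < k → Local _ (λ Y → Σ ℕ λ m → Eval Y _ _ (suc m))
  below j j<k with f j j<k
  ... | m , c with b , g ← eval-local c = b , λ Y ag → m , g Y ag
evalAll-local [] = 0 , λ _ _ → []
evalAll-local (a ∷ as) = local-map₂ _∷_ (eval-local a) (evalAll-local as)

-- Countability

-- A universal type of codes. It is enumerated once; products, sums, lists and programs are then
-- images of it by direct recursion, with no further arithmetic.
data Tree : Set where
  leaf : ℕ → Tree
  node : Tree → Tree → Tree

Countable : Set → Set
Countable A = Σ (ℕ → A) λ f → ∀ a → Σ ℕ λ n → f n ≡ a

unpair : ℕ → ℕ × ℕ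
unpair zero = 0 , 0
unpair (suc n) with unpair n
... | a , suc b = suc a , b
... | a , zero  = 0 , suc a

unpair-diagonal : ∀ a b n → unpair n ≡ (0 , a + b) → unpair (a + n) ≡ (a , b)
unpair-diagonal zero b n eq = eq
unpair-diagonal (suc a) b n eq
  rewrite unpair-diagonal a (suc b) n (trans eq (cong (0 ,_) (sym (+-suc a b)))) = refl

unpair-axis : ∀ d → Σ ℕ λ n → unpair n ≡ (0 , d)
unpair-axis zero = 0 , refl
unpair-axis (suc d) with unpair-axis d
... | n , eq = suc (d + n) , helper
  where
  helper : unpair (suc (d + n)) ≡ (0 , suc d)
  helper rewrite unpair-diagonal d 0 n (trans eq (cong (0 ,_) (sym (+-identityʳ d)))) = refl

unpair-surjective : ∀ a b → Σ ℕ λ n → unpair n ≡ (a , b)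
unpair-surjective a b with unpair-axis (a + b)
... | n , eq = a + n , unpair-diagonal a b n eq

-- The depth is fuel for the recursion. Any tree has a code at every sufficient depth, so two
-- subtrees of different depths can share one.
toTree : ℕ → ℕ → Tree
toTree zero n = leaf n
toTree (suc depth) n with unpair n
... | zero , m = leaf m
... | suc _ , m with unpair m
...   | a , b = node (subtree a) (subtree b)
  where
  subtree : ℕ → Tree
  subtree k = toTree depth k

Countable-Tree : Countable Tree
Countable-Tree = enum , surj
  where
  enum : ℕ → Tree
  enum n = toTree (proj₁ (unpair n)) (proj₂ (unpair n))
  depth : Tree → ℕ
  depth (leaf _) = 0
  depth (node s t) = suc (depth s ⊔ depth t)
  code : ∀ d t → depth t ≤ d → Σ ℕ λ n → toTree d n ≡ t
  code zero (leaf m) _ = m , refl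
  code (suc d) (leaf m) _ with unpair-surjective 0 m
  ... | n , eq = n , helper
    where
    helper : toTree (suc d) n ≡ leaf m
    helper rewrite eq = refl
  code (suc d) (node s t) (s≤s le)
    with code d s (≤-trans (m≤m⊔n _ _) le) | code d t (≤-trans (m≤n⊔m _ _) le)
  ... | a , eqa | b , eqb with unpair-surjective a b
  ... | m , eqm with unpair-surjective 1 m
  ... | n , eqn = n , helper
    where
    helper : toTree (suc d) n ≡ node s t
    helper rewrite eqn | eqm = cong₂ node eqa eqb
  surj : ∀ t → Σ ℕ λ n → enum n ≡ t
  surj t with code (depth t) t ≤-refl
  ... | k , eqk with unpair-surjective (depth t) k
  ... | n , eqn = n , trans (cong (λ p → toTree (proj₁ p) (proj₂ p)) eqn) eqk

Coded : Set → Set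
Coded A = Σ (Tree → A) λ f → ∀ a → Σ Tree λ t → f t ≡ a

coded-countable : ∀ {A} → Coded A → Countable A
coded-countable (f , surj) = (λ n → f (proj₁ Countable-Tree n)) , surj′
  where
  surj′ : ∀ a → Σ ℕ λ n → f (proj₁ Countable-Tree n) ≡ a
  surj′ a with surj a
  ... | t , refl with proj₂ Countable-Tree t
  ... | n , eq = n , cong f eq

coded-ℕ : Coded ℕ
coded-ℕ = (λ { (leaf n) → n ; (node _ _) → 0 }) , λ n → leaf n , refl

coded-Bool : Coded Bool
coded-Bool = (λ { (leaf _) → true ; (node _ _) → false }) ,
  λ { true → leaf 0 , refl ; false → node (leaf 0) (leaf 0) , refl }

coded-× : ∀ {A B} → Coded A → Coded B → Coded (A × B)
coded-× {A} {B} (f , f-surj) (g , g-surj) = dec , surj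
  where
  dec : Tree → A × B
  dec (leaf n) = f (leaf n) , g (leaf n)
  dec (node s t) = f s , g t
  surj : ∀ ab → Σ Tree λ t → dec t ≡ ab
  surj (a , b) = node (proj₁ (f-surj a)) (proj₁ (g-surj b)) , cong₂ _,_ (proj₂ (f-surj a)) (proj₂ (g-surj b))

coded-⊎ : ∀ {A B} → Coded A → Coded B → Coded (A ⊎ B)
coded-⊎ {A} {B} (f , f-surj) (g , g-surj) = dec , surj
  where
  dec : Tree → A ⊎ B
  dec (node (leaf _) t) = inj₁ (f t)
  dec (node (node _ _) t) = inj₂ (g t)
  dec (leaf n) = inj₁ (f (leaf n))
  surj : ∀ ab → Σ Tree λ t → dec t ≡ ab
  surj (inj₁ a) = node (leaf 0) (proj₁ (f-surj a)) , cong inj₁ (proj₂ (f-surj a))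
  surj (inj₂ b) = node (node (leaf 0) (leaf 0)) (proj₁ (g-surj b)) , cong inj₂ (proj₂ (g-surj b))

coded-List : ∀ {A} → Coded A → Coded (List A)
coded-List {A} (f , f-surj) = dec , surj
  where
  dec : Tree → List A
  dec (leaf _) = []
  dec (node s t) = f s ∷ dec t
  surj : ∀ as → Σ Tree λ t → dec t ≡ as
  surj [] = leaf 0 , refl
  surj (a ∷ as) = node (proj₁ (f-surj a)) (proj₁ (surj as)) , cong₂ _∷_ (proj₂ (f-surj a)) (proj₂ (surj as))

-- Only surjectivity matters, so codes that make no sense at arity `n` may all stand for `Z`.
decodeLeaf : ∀ n → ℕ → PR n
decodeLeaf n (suc (suc i)) with i <? n
... | yes i<n = P (Fin.fromℕ< i<n)
... | no  _   = Z
decodeLeaf 1 0 = S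
decodeLeaf 2 1 = orc
decodeLeaf _ _ = Z

decodePR  : ∀ n → Tree → PR n
decodePRs : ∀ n m → Tree → Vec (PR n) m
decodePR n (leaf k) = decodeLeaf n k
decodePR n (node (leaf 0) (node (leaf m) (node t ts))) = comp (decodePR m t) (decodePRs n m ts)
decodePR n (node (leaf 1) t) = mu (decodePR (suc n) t)
decodePR (suc n) (node (leaf 2) (node s t)) = prec (decodePR n s) (decodePR (suc (suc n)) t)
decodePR n _ = Z
decodePRs n zero _ = []
decodePRs n (suc m) (node t ts) = decodePR n t ∷ decodePRs n m ts
decodePRs n (suc m) (leaf k) = Z ∷ decodePRs n m (leaf k)

coded-PR : ∀ n → Coded (PR n)
coded-PR n = decodePR n , surj
  where
  surj  : ∀ {n} (e : PR n) → Σ Tree λ t → decodePR n t ≡ e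
  surjs : ∀ {n m} (es : Vec (PR n) m) → Σ Tree λ t → decodePRs n m t ≡ es
  -- This tree matches no proper clause of `decodePR` and falls through to the default.
  surj Z = node (node (leaf 0) (leaf 0)) (leaf 0) , refl
  surj S = leaf 0 , refl
  surj orc = leaf 1 , refl
  surj {n} (P i) = leaf (suc (suc (Fin.toℕ i))) , projection
    where
    projection : decodeLeaf n (suc (suc (Fin.toℕ i))) ≡ P i
    projection with Fin.toℕ i <? n
    ... | yes i<n = cong P (fromℕ<-toℕ i i<n)
    ... | no  i≮n = ⊥-elim (i≮n (toℕ<n i))
  surj (comp {m} g hs) with surj g | surjs hs
  ... | t , refl | ts , refl = node (leaf 0) (node (leaf m) (node t ts)) , refl
  surj (prec g h) with surj g | surj h
  ... | s , refl | t , refl = node (leaf 2) (node s t) , refl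
  surj (mu g) with surj g
  ... | t , refl = node (leaf 1) t , refl
  surjs [] = leaf 0 , refl
  surjs (e ∷ es) with surj e | surjs es
  ... | t , refl | ts , refl = node t ts , refl

-- Conditions

-- Only the entries of val and lim below len carry information.
record Cond : Set where
  constructor cond
  field
    len : ℕ
    val : Coloring
    lim : ℕ → Bool
open Cond public

infix 4 _≼_
-- A promised limit binds only columns added later: nothing relates `lim p x` to the values of `p`
-- below `len p`. The reversal of limits rests on this freedom.
record _≼_ (q p : Cond) : Set where
  field
    len≤ : len p ≤ len q
    val≡ : ∀ {x y} → x < len p → y < len p → val q x y ≡ val p x y
    lim≡ : ∀ {x} → x < len p → lim q x ≡ lim p x
    new  : ∀ {x y} → x < len p → len p ≤ y → y < len q → val q x y ≡ lim p x
open _≼_ public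

≼-refl : ∀ {p} → p ≼ p
≼-refl = record
  { len≤ = ≤-refl ; val≡ = λ _ _ → refl ; lim≡ = λ _ → refl
  ; new = λ _ p≤y y<p → ⊥-elim (<⇒≱ y<p p≤y) }

≼-trans : ∀ {r q p} → r ≼ q → q ≼ p → r ≼ p
≼-trans {r} {q} {p} r≼q q≼p = record
  { len≤ = ≤-trans (len≤ q≼p) (len≤ r≼q)
  ; val≡ = λ x< y< → trans (val≡ r≼q (up x<) (up y<)) (val≡ q≼p x< y<)
  ; lim≡ = λ x< → trans (lim≡ r≼q (up x<)) (lim≡ q≼p x<)
  ; new = newer }
  where
  up : ∀ {x} → x < len p → x < len q
  up x< = <-≤-trans x< (len≤ q≼p)
  newer : ∀ {x y} → x < len p → len p ≤ y → y < len r → val r x y ≡ lim p x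
  newer {x} {y} x< p≤y y<r with y <? len q
  ... | yes y<q = trans (val≡ r≼q (up x<) y<q) (new q≼p x< p≤y y<q)
  ... | no  y≮q = trans (new r≼q (up x<) (≮⇒≥ y≮q) y<r) (lim≡ q≼p x<)

choose : {Q A : Set} → Dec Q → A → A → A
choose (yes _) a _ = a
choose (no _)  _ b = b

choose-yes : {Q A : Set} (d : Dec Q) {a b : A} → Q → choose d a b ≡ a
choose-yes (yes _) _ = refl
choose-yes (no ¬q) q = ⊥-elim (¬q q)

choose-no : {Q A : Set} (d : Dec Q) {a b : A} → ¬ Q → choose d a b ≡ b
choose-no (yes q) ¬q = ⊥-elim (¬q q)
choose-no (no _) _ = refl

extend : Cond → ℕ → (ℕ → Bool) → Cond
extend p N g = record
  { len = len p ⊔ N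
  ; val = λ x y → choose (y <? len p) (val p x y) (lim p x)
  ; lim = λ x → choose (x <? len p) (lim p x) (g x) }

extend-≼ : ∀ p N g → extend p N g ≼ p
extend-≼ p N g = record
  { len≤ = m≤m⊔n _ _
  ; val≡ = λ {_} {y} _ y< → choose-yes (y <? len p) y<
  ; lim≡ = λ {x} x< → choose-yes (x <? len p) x<
  ; new = λ {_} {y} _ p≤y _ → choose-no (y <? len p) (≤⇒≯ p≤y) }

extend-len : ∀ p N g → N ≤ len (extend p N g)
extend-len p N g = m≤n⊔m (len p) N

extend-lim : ∀ p N g {x} → len p ≤ x → lim (extend p N g) x ≡ g x
extend-lim p N g {x} p≤x = choose-no (x <? len p) (≤⇒≯ p≤x)

setLim : Cond → ℕ → Bool → Cond
setLim p x b = record p { lim = λ y → choose (y ≟ x) b (lim p y) }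

setLim-≡ : ∀ p x b → lim (setLim p x b) x ≡ b
setLim-≡ p x b = choose-yes (x ≟ x) refl

setLim-≢ : ∀ p x b {y} → y ≢ x → lim (setLim p x b) y ≡ lim p y
setLim-≢ p x b {y} y≢x = choose-no (y ≟ x) y≢x

-- The number `x` is new relative to `p`, so `p` made no promise about it, even if `q` has already
-- acted on the old limit of `x`. The result need not be comparable with `q` itself.
setLim-≼ : ∀ {q p} x b → q ≼ p → len p ≤ x → setLim q x b ≼ p
setLim-≼ {q} x b q≼p p≤x = record
  { len≤ = len≤ q≼p ; val≡ = val≡ q≼p ; new = new q≼p
  ; lim≡ = λ y< → trans (setLim-≢ q x b (<⇒≢ (<-≤-trans y< p≤x))) (lim≡ q≼p y<) }

-- Finite approximations to the solution

Approx : Set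
Approx = List (Bool × ℕ)

bound : Approx → ℕ
bound [] = 0
bound ((_ , y) ∷ _) = suc y

elt : Bool → ℕ → ℕ
elt false n = n * 2
elt true  n = suc (n * 2)

-- The bound `K` depends on the approximation reached, because the point beyond which a further
-- element is harmless depends on the elements already chosen; see `split-exists`.
data Ext (X : Subset) (K : Approx → ℕ) (F : Approx) : Approx → Set where
  done : Ext X K F F
  add  : ∀ {G s y} → Ext X K F G → X y ≡ true → K G ≤ y → Ext X K F ((s , y) ∷ G)

Ext-trans : ∀ {X K F G H} → Ext X K F G → Ext X K G H → Ext X K F H
Ext-trans E done = E
Ext-trans E (add E′ inX le) = add (Ext-trans E E′) inX le

Ext-mono : ∀ {X K K′ F G} → (∀ H → K H ≤ K′ H) → Ext X K′ F G → Ext X K F G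
Ext-mono K≤ done = done
Ext-mono K≤ (add {G} E inX le) = add (Ext-mono K≤ E) inX (≤-trans (K≤ G) le)

Ext-∈ : ∀ {X K F G u} → Ext X K F G → u ∈ F → u ∈ G
Ext-∈ done u∈ = u∈
Ext-∈ (add E _ _) u∈ = there (Ext-∈ E u∈)

Ext-∈⁻ : ∀ {X K F G N s y} → (∀ H → N ≤ K H) → Ext X K F G → (s , y) ∈ G →
         (s , y) ∈ F ⊎ (X y ≡ true × N ≤ y)
Ext-∈⁻ N≤ done u∈ = inj₁ u∈
Ext-∈⁻ N≤ (add {G} E inX le) (here refl) = inj₂ (inX , ≤-trans (N≤ G) le)
Ext-∈⁻ N≤ (add E _ _) (there u∈) = Ext-∈⁻ N≤ E u∈

Sorted : Approx → Set
Sorted [] = ⊤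
Sorted ((_ , y) ∷ F) = Sorted F × bound F ≤ y

Sorted-bound : ∀ {F s y} → Sorted F → (s , y) ∈ F → y < bound F
Sorted-bound (_ , le) (here refl) = ≤-refl
Sorted-bound {(_ , _) ∷ F} (so , le) (there u∈) = m<n⇒m<1+n (<-≤-trans (Sorted-bound so u∈) le)

Sorted-Ext : ∀ {X K F G} → Ext X K F G → Sorted G → Sorted F
Sorted-Ext done so = so
Sorted-Ext (add E _ _) (so , _) = Sorted-Ext E so

Ext-bound : ∀ {X K F G} → Ext X K F G → Sorted G → bound F ≤ bound G
Ext-bound done _ = ≤-refl
Ext-bound (add E _ _) (so , le) = m≤n⇒m≤1+n (≤-trans (Ext-bound E so) le)

Ext-below : ∀ {X K F G s y} → Ext X K F G → Sorted G → (s , y) ∈ G → y < bound F → (s , y) ∈ F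
Ext-below done _ u∈ _ = u∈
Ext-below (add E _ _) (so , le) (here refl) y< =
  ⊥-elim (<⇒≱ y< (≤-trans (Ext-bound E so) le))
Ext-below (add E _ _) (so , _) (there u∈) y< = Ext-below E so u∈ y<

-- Elements enter in increasing order regardless of side, so one bound serves both halves, and
-- absence below it is as final as presence.
_Extends_ : Subset → Approx → Set
H Extends F = ∀ s n → n < bound F → (H (elt s n) ≡ true → (s , n) ∈ F) × ((s , n) ∈ F → H (elt s n) ≡ true)

Extends-Ext : ∀ {X K F G H} → Ext X K F G → Sorted G → H Extends G → H Extends F
Extends-Ext E so ext s n n<
  with to , from ← ext s n (<-≤-trans n< (Ext-bound E so)) =
  (λ Hn → Ext-below E so (to Hn) n<) , (λ u∈ → from (Ext-∈ E u∈))

-- Outputs and bigness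

Out : PR 1 → Approx → ℕ → Set
Out ψ F x = ∀ H → H Extends F → Eval (setOracle H) ψ (x ∷ []) 1

Out-mono : ∀ {ψ X K F G x} → Ext X K F G → Sorted G → Out ψ F x → Out ψ G x
Out-mono E so out H ext = out H (Extends-Ext {H = H} E so ext)

Almost : Subset → (ℕ → Set) → Set
Almost X Q = Σ ℕ λ N → ∀ y → N ≤ y → X y ≡ true → Q y

-- A well-founded tree whose nodes have unboundedly large children in `X`. Unbounded branching is
-- what allows a path to be chosen later, under any condition and any bounds; see `follow`.
data Big (ψ : PR 1) (X : Subset) (x : ℕ) (F : Approx) : Set where
  now  : Out ψ F x → Big ψ X x F
  step : (h : ℕ → Bool × ℕ) → (∀ k → k ≤ proj₂ (h k)) → (∀ k → X (proj₂ (h k)) ≡ true) →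
         (∀ k → Big ψ X x (h k ∷ F)) → Big ψ X x F

_⊆_ : Subset → Subset → Set
Y ⊆ X = ∀ {y} → Y y ≡ true → X y ≡ true

_⊆*_ : Subset → Subset → Set
Y ⊆* X = Almost Y (λ y → X y ≡ true)

Big-mono : ∀ {ψ X Y x F} → Y ⊆* X → Big ψ Y x F → Big ψ X x F
Big-mono Y⊆X (now out) = now out
Big-mono (N , Y⊆X) (step h ge inY sub) =
  step (λ k → h (k ⊔ N)) (λ k → ≤-trans (m≤m⊔n k N) (ge (k ⊔ N)))
    (λ k → Y⊆X _ (≤-trans (m≤n⊔m k N) (ge (k ⊔ N))) (inY (k ⊔ N)))
    (λ k → Big-mono (N , Y⊆X) (sub (k ⊔ N)))

max-below : (Q : ℕ → ℕ → Set) → (∀ {x N M} → N ≤ M → Q x N → Q x M) → (∀ x → Σ ℕ (Q x)) →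
            ∀ k → Σ ℕ λ N → ∀ x → x < k → Q x N
max-below Q up f zero = 0 , λ _ ()
max-below Q up f (suc k) with max-below Q up f k | f k
... | N , q | M , q′ = N ⊔ M , go
  where
  go : ∀ x → x < suc k → Q x (N ⊔ M)
  go x x<sk with m≤n⇒m<n∨m≡n (≤-pred x<sk)
  ... | inj₁ x<k = up (m≤m⊔n N M) (q x x<k)
  ... | inj₂ refl = up (m≤n⊔m N M) q′

extend-all : ∀ {q} (Q : Cond → Bool × ℕ → Set) → (∀ {r r′ u} → r′ ≼ r → Q r u → Q r′ u) →
             ∀ G → (∀ u → u ∈ G → ∀ r → r ≼ q → Σ Cond λ r′ → r′ ≼ r × Q r′ u) →
             ∀ r → r ≼ q → Σ Cond λ r′ → r′ ≼ r × (∀ u → u ∈ G → Q r′ u)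
extend-all Q mono [] dense r _ = r , ≼-refl , λ _ ()
extend-all Q mono (u ∷ G) dense r r≼q
  with r₁ , r₁≼r , all ← extend-all Q mono G (λ v v∈ → dense v (there v∈)) r r≼q
  with r₂ , r₂≼r₁ , at ← dense u (here refl) r₁ (≼-trans r₁≼r r≼q) =
  r₂ , ≼-trans r₂≼r₁ r₁≼r , λ { _ (here refl) → at ; v (there v∈) → mono r₂≼r₁ (all v v∈) }

-- Forcing statements about the functional

module _ (e : PR 2) where

  -- Independent of lim, hence unaffected by setLim.
  Forces : Cond → ℕ → ℕ → Bool → Set
  Forces p x y v = ∀ g → (∀ {a b} → a < len p → b < len p → g a b ≡ val p a b) →
                   Eval (colOracle g) e (x ∷ y ∷ []) (bit v)

  Forces-mono : ∀ {p q x y v} → q ≼ p → Forces p x y v → Forces q x y v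
  Forces-mono q≼p fo g ag = fo g λ a< b< →
    trans (ag (<-≤-trans a< (len≤ q≼p)) (<-≤-trans b< (len≤ q≼p))) (val≡ q≼p a< b<)

  -- Deciding in the weak sense: no extension can force the other value from `len p` on. That values
  -- get forced at all is left to `Convergent`. The quantifier over extensions makes this depend on
  -- `lim`, unlike `Forces`.
  Decides : Cond → ℕ → Bool → Set
  Decides p x c = ∀ q y v → q ≼ p → len p ≤ y → Forces q x y v → v ≡ c

  Decides-mono : ∀ {p q x c} → q ≼ p → Decides p x c → Decides q x c
  Decides-mono q≼p de r y v r≼q q≤y fo = de r y v (≼-trans r≼q q≼p) (≤-trans (len≤ q≼p) q≤y) fo

  Convergent : Cond → Set
  Convergent p = ∀ q → q ≼ p → ∀ x y → Σ Cond λ r → r ≼ q × Σ Bool (Forces r x y)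

  Deciding : Cond → Set
  Deciding p = ∀ q → q ≼ p → ∀ x → Σ Cond λ r → r ≼ q × Σ Bool (Decides r x)

  Pairs : Bool → Cond → Approx → Set
  Pairs i p [] = ⊤
  Pairs i p ((s , y) ∷ F) = Pairs i p F × (∀ {t a} → (t , a) ∈ F → t ≢ s → Forces p a y i)

  Pairs-map : ∀ {i p q} → (∀ {a y v} → Forces p a y v → Forces q a y v) →
              ∀ F → Pairs i p F → Pairs i q F
  Pairs-map h [] _ = tt
  Pairs-map h (_ ∷ F) (ps , fo) = Pairs-map h F ps , λ u∈ t≢s → h (fo u∈ t≢s)

  record Valid (i : Bool) (p : Cond) (F : Approx) : Set where
    constructor valid
    field
      sorted : Sorted F
      pairs : Pairs i p F
      decided : ∀ {t a} → (t , a) ∈ F → Decides p a i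
  open Valid public

  Valid-mono : ∀ {i p q F} → q ≼ p → Valid i p F → Valid i q F
  Valid-mono {F = F} q≼p (valid so ps de) =
    valid so (Pairs-map (Forces-mono q≼p) F ps) (λ u∈ → Decides-mono q≼p (de u∈))

  Valid-tail : ∀ {i p u F} → Valid i p (u ∷ F) → Valid i p F
  Valid-tail (valid (so , _) (ps , _) de) = valid so ps (λ u∈ → de (there u∈))

  -- Required of every infinite subset, since it is applied to the children of a node in a bigness
  -- tree, which may be any infinite part of `X`.
  Rich : Bool → Subset → Cond → Set
  Rich i X p = ∀ q → q ≼ p → ∀ Y → Y ⊆ X → Infinite Y →
               Σ ℕ λ y → Y y ≡ true × Σ Cond λ r → r ≼ q × Decides r y i

-- bnd F is a lower bound for the next element to be added to F; raising it is how an
-- extension promises that ψ will output nothing more.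
record Mathias : Set where
  constructor mathias
  field
    cnd : Cond
    fin : Approx
    bnd : Approx → ℕ
open Mathias public

record _⊢_⊑_ (X : Subset) (d c : Mathias) : Set where
  constructor ext
  field
    cnd≼ : cnd d ≼ cnd c
    bnd≤ : ∀ G → bnd c G ≤ bnd d G
    fin-ext : Ext X (bnd c) (fin c) (fin d)
open _⊢_⊑_ public

⊑-refl : ∀ {X c} → X ⊢ c ⊑ c
⊑-refl = ext ≼-refl (λ _ → ≤-refl) done

⊑-trans : ∀ {X c d b} → X ⊢ d ⊑ c → X ⊢ c ⊑ b → X ⊢ d ⊑ b
⊑-trans (ext p k E) (ext p′ k′ E′) =
  ext (≼-trans p p′) (λ G → ≤-trans (k′ G) (k G)) (Ext-trans E′ (Ext-mono k′ E))

module _ (ψ : PR 1) where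

  -- No set homogeneous for an extension of `p` contains both outputs: its elements all have its
  -- colour as limit, and also as value with every later element.
  Bad : Cond → Approx → Set
  Bad p F = Σ ℕ λ x → Σ ℕ λ x′ → Out ψ F x × Out ψ F x′ × x < len p × x′ < len p ×
            (lim p x ≢ lim p x′ ⊎ (x < x′ × val p x x′ ≢ lim p x))

  Bad-mono : ∀ {X K p q F G} → q ≼ p → Ext X K F G → Sorted G → Bad p F → Bad q G
  Bad-mono {p = p} {q} q≼p E so (x , x′ , o , o′ , x< , x′< , clash) =
    x , x′ , Out-mono E so o , Out-mono E so o′ ,
    <-≤-trans x< (len≤ q≼p) , <-≤-trans x′< (len≤ q≼p) , go clash
    where
    go : lim p x ≢ lim p x′ ⊎ (x < x′ × val p x x′ ≢ lim p x) →
         lim q x ≢ lim q x′ ⊎ (x < x′ × val q x x′ ≢ lim q x)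
    go (inj₁ ne) rewrite lim≡ q≼p x< | lim≡ q≼p x′< = inj₁ ne
    go (inj₂ (lt , ne)) rewrite lim≡ q≼p x< | val≡ q≼p x< x′< = inj₂ (lt , ne)

  module _ (e : PR 2) (i : Bool) (X : Subset) where

    -- This defeats `ψ` because an infinite set computed from the solution has an element beyond
    -- `m`, and a finite part of the solution suffices to output it.
    Quiet : Mathias → Set
    Quiet c = Σ ℕ λ m → ∀ q G → q ≼ cnd c → Ext X (bnd c) (fin c) G → Valid e i q G →
              ∀ x → m ≤ x → ¬ Out ψ G x

    Avoids : Mathias → Set
    Avoids c = Bad (cnd c) (fin c) ⊎ Quiet c

    Avoids-mono : ∀ {c d} → X ⊢ d ⊑ c → Sorted (fin d) → Avoids c → Avoids d
    Avoids-mono (ext p k E) so (inj₁ bad) = inj₁ (Bad-mono p E so bad)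
    Avoids-mono (ext p k E) so (inj₂ (m , quiet)) =
      inj₂ (m , λ q G q≼ E′ → quiet q G (≼-trans q≼ p) (Ext-trans E (Ext-mono k E′)))

-- Reservoirs

module Classical (em : ExcludedMiddle 0ℓ) where

  dne : {Q : Set} → ¬ ¬ Q → Q
  dne {Q} ¬¬q with em {Q}
  ... | yes q = q
  ... | no ¬q = ⊥-elim (¬¬q ¬q)

  ¬∀⇒∃¬ : {A : Set} {Q : A → Set} → ¬ (∀ a → Q a) → Σ A λ a → ¬ Q a
  ¬∀⇒∃¬ ¬all = dne λ none → ¬all λ a → dne λ ¬q → none (a , ¬q)

  ⟦_⟧ : (ℕ → Set) → Subset
  ⟦ Q ⟧ n = does (em {Q n})

  ⟦⟧-intro : (Q : ℕ → Set) {n : ℕ} → Q n → ⟦ Q ⟧ n ≡ true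
  ⟦⟧-intro Q {n} q with em {Q n}
  ... | yes _ = refl
  ... | no ¬q = ⊥-elim (¬q q)

  ⟦⟧-elim : (Q : ℕ → Set) {n : ℕ} → ⟦ Q ⟧ n ≡ true → Q n
  ⟦⟧-elim Q {n} eq with em {Q n} | eq
  ... | yes q | _ = q
  ... | no _  | ()

  -- Diagonal intersection of a decreasing sequence of reservoirs

  module Fusion (D : ℕ → Subset → Set)
    (hereditary : ∀ {n X Y} → D n X → Infinite Y → Y ⊆* X → D n Y)
    (dense : ∀ n X → Infinite X → Σ Subset λ Y → Y ⊆ X × Infinite Y × D n Y)
    (X₀ : Subset) (X₀-inf : Infinite X₀) where

    stage : ℕ → Σ Subset Infinite
    stage zero = X₀ , X₀-inf
    stage (suc n) with X , inf ← stage n with Y , _ , Y-inf , _ ← dense n X inf = Y , Y-inf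

    reservoir : ℕ → Subset
    reservoir n = proj₁ (stage n)

    decreasing : ∀ n → reservoir (suc n) ⊆ reservoir n
    decreasing n = proj₁ (proj₂ (dense n (proj₁ (stage n)) (proj₂ (stage n))))

    met : ∀ n → D n (reservoir (suc n))
    met n = proj₂ (proj₂ (proj₂ (dense n (proj₁ (stage n)) (proj₂ (stage n)))))

    decreasing-≤ : ∀ {m n} → m ≤ n → reservoir n ⊆ reservoir m
    decreasing-≤ {n = zero} z≤n inX = inX
    decreasing-≤ {m} {suc n} m≤sn inX with m≤n⇒m<n∨m≡n m≤sn
    ... | inj₁ m<sn = decreasing-≤ (≤-pred m<sn) (decreasing n inX)
    ... | inj₂ refl = inX

    point : ℕ → ℕ
    point zero = proj₁ (proj₂ (stage 1) 0)
    point (suc n) = proj₁ (proj₂ (stage (suc (suc n))) (suc (point n)))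

    point-∈ : ∀ n → reservoir (suc n) (point n) ≡ true
    point-∈ zero = proj₂ (proj₂ (proj₂ (stage 1) 0))
    point-∈ (suc n) = proj₂ (proj₂ (proj₂ (stage (suc (suc n))) (suc (point n))))

    point-suc : ∀ n → point n < point (suc n)
    point-suc n = proj₁ (proj₂ (proj₂ (stage (suc (suc n))) (suc (point n))))

    point-< : ∀ {m n} → m < n → point m < point n
    point-< {m} {suc n} (s≤s m≤n) with m≤n⇒m<n∨m≡n m≤n
    ... | inj₁ m<n = <-trans (point-< m<n) (point-suc n)
    ... | inj₂ refl = point-suc n

    n≤point : ∀ n → n ≤ point n
    n≤point zero = z≤n
    n≤point (suc n) = ≤-<-trans (n≤point n) (point-suc n)

    Q : ℕ → Set
    Q y = Σ ℕ λ n → point n ≡ y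

    fused : Subset
    fused = ⟦ Q ⟧

    fused-infinite : Infinite fused
    fused-infinite n = point n , n≤point n , ⟦⟧-intro Q (n , refl)

    fused-⊆* : ∀ n → fused ⊆* reservoir (suc n)
    fused-⊆* n = point n , λ y le inF → go y le (⟦⟧-elim Q inF)
      where
      go : ∀ y → point n ≤ y → Q y → reservoir (suc n) y ≡ true
      go y le (m , refl) with m <? n
      ... | yes m<n = ⊥-elim (<⇒≱ (point-< m<n) le)
      ... | no m≮n = decreasing-≤ (s≤s (≮⇒≥ m≮n)) (point-∈ m)

    fused-⊆ : fused ⊆ X₀
    fused-⊆ inF with m , refl ← ⟦⟧-elim Q inF = decreasing-≤ {0} {suc m} z≤n (point-∈ m)

    fused-met : ∀ n → D n fused
    fused-met n = hereditary (met n) fused-infinite (fused-⊆* n)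

  -- The diagonal set is only almost contained in each reservoir of the sequence; this is why the
  -- requirements must be hereditary under almost inclusion.
  fusion : {I : Set} → Countable I → (D : I → Subset → Set) →
    (∀ {i X Y} → D i X → Infinite Y → Y ⊆* X → D i Y) →
    (∀ i X → Infinite X → Σ Subset λ Y → Y ⊆ X × Infinite Y × D i Y) →
    ∀ X → Infinite X → Σ Subset λ Y → Y ⊆ X × Infinite Y × (∀ i → D i Y)
  fusion (enum , surj) D her dense X inf = fused , fused-⊆ , fused-infinite , all
    where
    open Fusion (λ n → D (enum n)) her (λ n → dense (enum n)) X inf
    all : ∀ i → D i fused
    all i with surj i
    ... | n , refl = fused-met n

  intersect-infinite : ∀ {X} Y → Infinite Y → Y ⊆* X →
    Σ Subset λ W → W ⊆ X × W ⊆ Y × Infinite W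
  intersect-infinite {X} Y inf (N , sub) = ⟦ Q ⟧ ,
    (λ inW → proj₂ (⟦⟧-elim Q inW)) , (λ inW → proj₁ (⟦⟧-elim Q inW)) , infinite
    where
    Q : ℕ → Set
    Q y = Y y ≡ true × X y ≡ true
    infinite : Infinite ⟦ Q ⟧
    infinite n with inf (n ⊔ N)
    ... | y , le , inY = y , ≤-trans (m≤m⊔n n N) le ,
      ⟦⟧-intro Q (inY , sub y (≤-trans (m≤n⊔m n N) le) inY)

  ¬Almost-infinite : ∀ {X Q} → ¬ Almost X Q → Infinite ⟦ (λ y → X y ≡ true × ¬ Q y) ⟧
  ¬Almost-infinite {X} {Q} ¬al n with em {Σ ℕ λ y → n ≤ y × X y ≡ true × ¬ Q y}
  ... | yes (y , le , q) = y , le , ⟦⟧-intro (λ y → X y ≡ true × ¬ Q y) q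
  ... | no none = ⊥-elim (¬al (n , λ y le inX → dne λ ¬q → none (y , le , inX , ¬q)))

  Robust : Subset → Set
  Robust X = ∀ ψ F x → Big ψ X x F → ∀ Y → Y ⊆ X → Infinite Y → Big ψ Y x F

  -- Turns statements about infinitely many `y` into statements about almost all `y`, so that
  -- several of them can be imposed on a single `y`.
  Nice : Subset → Set
  Nice X = ∀ ψ F s k →
    Almost X (λ y → Σ ℕ λ x → k ≤ x × Big ψ X x ((s , y) ∷ F)) ⊎
    Almost X (λ y → ∀ x → k ≤ x → ¬ Big ψ X x ((s , y) ∷ F))

  ⊆⇒⊆* : ∀ {X Y} → Y ⊆ X → Y ⊆* X
  ⊆⇒⊆* sub = 0 , λ _ _ → sub

  ⊆*-trans : ∀ {X Y W} → W ⊆* Y → Y ⊆* X → W ⊆* X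
  ⊆*-trans (N , f) (M , g) = N ⊔ M , λ y le inW →
    g y (≤-trans (m≤n⊔m N M) le) (f y (≤-trans (m≤m⊔n N M) le) inW)

  coded-Approx : Coded Approx
  coded-Approx = coded-List (coded-× coded-Bool coded-ℕ)

  -- Shrinking the reservoir can only destroy bigness. For each of countably many data, either some
  -- subset destroys it for good or every subset keeps it.
  robust-exists : ∀ X → Infinite X → Σ Subset λ Y → Y ⊆ X × Infinite Y × Robust Y
  robust-exists X inf with fusion
      (coded-countable (coded-× (coded-PR 1) (coded-× coded-Approx coded-ℕ))) D hereditary dense X inf
    where
    D : PR 1 × Approx × ℕ → Subset → Set
    D (ψ , F , x) X = ¬ Big ψ X x F ⊎ (∀ Y → Y ⊆* X → Infinite Y → Big ψ Y x F)
    hereditary : ∀ {i X Y} → D i X → Infinite Y → Y ⊆* X → D i Y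
    hereditary (inj₁ ¬big) _ sub = inj₁ λ big → ¬big (Big-mono sub big)
    hereditary (inj₂ all) _ sub = inj₂ λ W W⊆Y → all W (⊆*-trans W⊆Y sub)
    dense : ∀ i X → Infinite X → Σ Subset λ Y → Y ⊆ X × Infinite Y × D i Y
    dense (ψ , F , x) X inf with em {Σ Subset λ Y → Y ⊆ X × Infinite Y × ¬ Big ψ Y x F}
    ... | yes (Y , sub , Y-inf , ¬big) = Y , sub , Y-inf , inj₁ ¬big
    ... | no none = X , (λ inX → inX) , inf , inj₂ all
      where
      all : ∀ Y → Y ⊆* X → Infinite Y → Big ψ Y x F
      all Y sub Y-inf with intersect-infinite Y Y-inf sub
      ... | W , W⊆X , W⊆Y , W-inf =
        Big-mono (⊆⇒⊆* W⊆Y) (dne λ ¬big → none (W , W⊆X , W-inf , ¬big))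
  ... | Y , Y⊆X , Y-inf , all = Y , Y⊆X , Y-inf , robust
    where
    robust : Robust Y
    robust ψ F x big with all (ψ , F , x)
    ... | inj₁ ¬big = ⊥-elim (¬big big)
    ... | inj₂ al = λ W W⊆Y → al W (⊆⇒⊆* W⊆Y)

  Robust-⊆ : ∀ {X Y} → Robust X → Y ⊆ X → Robust Y
  Robust-⊆ rob sub ψ F x big W W⊆Y = rob ψ F x (Big-mono (⊆⇒⊆* sub) big) W (λ inW → sub (W⊆Y inW))

  Nice-⊆ : ∀ {X Y} → Robust X → Nice X → Y ⊆ X → Infinite Y → Nice Y
  Nice-⊆ rob nice sub inf ψ F s k with nice ψ F s k
  ... | inj₁ (N , f) = inj₁ (N , λ y le inY → go (f y le (sub inY)))
    where
    go : ∀ {y} → Σ ℕ (λ x → k ≤ x × Big ψ _ x ((s , y) ∷ F)) → Σ ℕ (λ x → k ≤ x × Big ψ _ x ((s , y) ∷ F))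
    go (x , le , big) = x , le , rob ψ _ x big _ sub inf
  ... | inj₂ (N , f) = inj₂ (N , λ y le inY x k≤x big → f y le (sub inY) x k≤x (Big-mono (⊆⇒⊆* sub) big))

  nice-exists : Σ Subset λ X → Infinite X × Robust X × Nice X
  nice-exists with robust-exists (λ _ → true) (λ n → n , ≤-refl , refl)
  ... | X , _ , inf , rob with fusion
      (coded-countable (coded-× (coded-PR 1) (coded-× coded-Approx (coded-× coded-Bool coded-ℕ))))
      D hereditary dense X inf
    where
    -- Bigness is taken in the fixed robust `X`, so the predicate does not change while `Y` is
    -- thinned; robustness transfers it to the final reservoir.
    E : PR 1 → Approx → Bool → ℕ → ℕ → Set
    E ψ F s k y = Σ ℕ λ x → k ≤ x × Big ψ X x ((s , y) ∷ F)
    D : PR 1 × Approx × Bool × ℕ → Subset → Set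
    D (ψ , F , s , k) Y = Almost Y (E ψ F s k) ⊎ Almost Y (λ y → ¬ E ψ F s k y)
    thin : ∀ {Q : ℕ → Set} {Y W} → W ⊆* Y → Almost Y Q → Almost W Q
    thin (N , sub) (M , f) = N ⊔ M , λ y le inW →
      f y (≤-trans (m≤n⊔m N M) le) (sub y (≤-trans (m≤m⊔n N M) le) inW)
    hereditary : ∀ {i Y W} → D i Y → Infinite W → W ⊆* Y → D i W
    hereditary (inj₁ al) _ sub = inj₁ (thin sub al)
    hereditary (inj₂ al) _ sub = inj₂ (thin sub al)
    dense : ∀ i Y → Infinite Y → Σ Subset λ W → W ⊆ Y × Infinite W × D i W
    dense (ψ , F , s , k) Y inf with em {Almost Y (E ψ F s k)}
    ... | yes al = Y , (λ inY → inY) , inf , inj₁ al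
    ... | no ¬al = _ , (λ inW → proj₁ (⟦⟧-elim Q inW)) , ¬Almost-infinite ¬al ,
                   inj₂ (0 , λ y _ inW → proj₂ (⟦⟧-elim Q inW))
      where
      Q : ℕ → Set
      Q y = Y y ≡ true × ¬ E ψ F s k y
  ... | Y , Y⊆X , Y-inf , all = Y , Y-inf , Robust-⊆ rob Y⊆X , nice
    where
    nice : Nice Y
    nice ψ F s k with all (ψ , F , s , k)
    ... | inj₁ (N , f) = inj₁ (N , λ y le inY → go (f y le inY))
      where
      go : ∀ {y} → Σ ℕ (λ x → k ≤ x × Big ψ X x ((s , y) ∷ F)) → Σ ℕ (λ x → k ≤ x × Big ψ Y x ((s , y) ∷ F))
      go (x , le , big) = x , le , rob ψ _ x big Y Y⊆X Y-inf
    ... | inj₂ (N , f) = inj₂ (N , λ y le inY x k≤x big → f y le inY (x , k≤x , Big-mono (⊆⇒⊆* Y⊆X) big))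

-- Unavoidable functionals

not≢ : ∀ b → not b ≢ b
not≢ false ()
not≢ true ()

bool-pigeonhole : ∀ {a b c : Bool} → a ≢ b → a ≢ c → b ≡ c
bool-pigeonhole a≢b a≢c = trans (¬-not (λ eq → a≢b (sym eq))) (sym (¬-not (λ eq → a≢c (sym eq))))

⊔-≤ : ∀ {a b c} → a ⊔ b ≤ c → a ≤ c × b ≤ c
⊔-≤ {a} {b} le = ≤-trans (m≤m⊔n a b) le , ≤-trans (m≤n⊔m a b) le

module Core (em : ExcludedMiddle 0ℓ) where
  open Classical em

  -- Extending valid approximations of one colour

  module Colour (e : PR 2) (X : Subset) (p₀ : Cond) (convergent : Convergent e p₀)
    (deciding : Deciding e p₀) (i : Bool) (rich : Rich e i X p₀) where

    -- Some value at `(a , y)` can be forced by convergence, and the decision about `a` leaves only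
    -- `i`. Each `a` may have been decided at its own condition, provided that this is no longer
    -- than `y`.
    force-column : ∀ {q} s y F → q ≼ p₀ →
      (∀ {t a} → (t , a) ∈ F → t ≢ s → Σ Cond λ q′ → q ≼ q′ × Decides e q′ a i × len q′ ≤ y) →
      Σ Cond λ r → r ≼ q × (∀ {t a} → (t , a) ∈ F → t ≢ s → Forces e r a y i)
    force-column {q} s y F q≼p₀ dec
      with extend-all Q mono F dense q ≼-refl
      where
      Q : Cond → Bool × ℕ → Set
      Q r (t , a) = t ≢ s → Forces e r a y i
      mono : ∀ {r r′ u} → r′ ≼ r → Q r u → Q r′ u
      mono r′≼r fo t≢s = Forces-mono e r′≼r (fo t≢s)
      dense : ∀ u → u ∈ F → ∀ r → r ≼ q → Σ Cond λ r′ → r′ ≼ r × Q r′ u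
      dense (t , a) u∈ r r≼q with t Bool.≟ s
      ... | yes t≡s = r , ≼-refl , λ t≢s → ⊥-elim (t≢s t≡s)
      ... | no t≢s with dec u∈ t≢s | convergent r (≼-trans r≼q q≼p₀) a y
      ... | q′ , q≼q′ , de , le | r′ , r′≼r , v , fo
        with refl ← de r′ y v (≼-trans r′≼r (≼-trans r≼q q≼q′)) le fo = r′ , r′≼r , λ _ → fo
    ... | r , r≼q , all = r , r≼q , λ u∈ → all _ u∈

    -- Only `q`, at which the members of `F` are decided, has to end before `y`; the condition `r`
    -- that decides `y` may be far longer.
    add-element : ∀ {q F y r} s → q ≼ p₀ → Valid e i q F → len q ≤ y → bound F ≤ y →
      r ≼ q → Decides e r y i → Σ Cond λ r′ → r′ ≼ r × Valid e i r′ ((s , y) ∷ F)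
    add-element {q} {F} {y} {r} s q≼p₀ va q≤y F≤y r≼q de
      with force-column s y F (≼-trans r≼q q≼p₀) (λ u∈ _ → q , r≼q , decided va u∈ , q≤y)
    ... | r′ , r′≼r , fo = r′ , r′≼r ,
      valid (sorted va , F≤y) (pairs (Valid-mono e (≼-trans r′≼r r≼q) va) , fo)
        λ { (here refl) → Decides-mono e r′≼r de
          ; (there u∈) → Decides-mono e (≼-trans r′≼r r≼q) (decided va u∈) }

    rich-sequence : ∀ {q} → q ≼ p₀ → (h : ℕ → ℕ) → (∀ k → k ≤ h k) → (∀ k → X (h k) ≡ true) →
      ∀ M → Σ ℕ λ k → M ≤ k × Σ Cond λ r → r ≼ q × Decides e r (h k) i
    rich-sequence {q} q≼p₀ h ge inX M =
      found (rich q q≼p₀ ⟦ Q ⟧ (λ inQ → Q⊆X (⟦⟧-elim Q inQ)) infinite)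
      where
      Q : ℕ → Set
      Q y = Σ ℕ λ k → M ≤ k × h k ≡ y
      Q⊆X : ∀ {y} → Q y → X y ≡ true
      Q⊆X (k , _ , refl) = inX k
      infinite : Infinite ⟦ Q ⟧
      infinite n = h (n ⊔ M) , ≤-trans (m≤m⊔n n M) (ge (n ⊔ M)) ,
        ⟦⟧-intro Q (n ⊔ M , m≤n⊔m n M , refl)
      found : Σ ℕ (λ y → ⟦ Q ⟧ y ≡ true × Σ Cond λ r → r ≼ q × Decides e r y i) →
              Σ ℕ λ k → M ≤ k × Σ Cond λ r → r ≼ q × Decides e r (h k) i
      found (y , inQ , r , r≼q , de) with ⟦⟧-elim Q inQ
      ... | k , M≤k , refl = k , M≤k , r , r≼q , de

    -- Richness picks, at each node, a child beyond everything fixed so far whose limit can be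
    -- decided as `i`. As children are unboundedly large, any `K` can be respected.
    follow : ∀ {ψ x q F} K → q ≼ p₀ → Valid e i q F → Big ψ X x F →
      Σ Cond λ q′ → Σ Approx λ F′ → q′ ≼ q × Ext X K F F′ × Valid e i q′ F′ × Out ψ F′ x
    follow K q≼p₀ va (now out) = _ , _ , ≼-refl , done , va , out
    follow {ψ} {x} {q} {F} K q≼p₀ va (step h ge inX sub)
      with rich-sequence q≼p₀ (λ k → proj₂ (h k)) ge inX (len q ⊔ bound F ⊔ K F)
    ... | k , M≤k , r , r≼q , de
      with M≤y ← ≤-trans M≤k (ge k)
      with add-element (proj₁ (h k)) q≼p₀ va (≤-trans (m≤m⊔n _ _) (≤-trans (m≤m⊔n _ _) M≤y))
             (≤-trans (m≤n⊔m (len q) _) (≤-trans (m≤m⊔n _ _) M≤y)) r≼q de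
    ... | r′ , r′≼r , va′ with follow K (≼-trans r′≼r (≼-trans r≼q q≼p₀)) va′ (sub k)
    ... | q″ , F″ , q″≼ , E , va″ , out =
      q″ , F″ , ≼-trans q″≼ (≼-trans r′≼r r≼q) ,
      Ext-trans (add done (inX k) (≤-trans (m≤n⊔m (len q ⊔ bound F) _) M≤y)) E , va″ , out

    Unavoidable : PR 1 → Mathias → Set
    Unavoidable ψ c = ∀ d → X ⊢ d ⊑ c → Valid e i (cnd d) (fin d) → ¬ Avoids ψ e i X d

    -- If no output could be reached, `c` itself would be quiet with threshold 0. The condition is
    -- lengthened to `suc x` so that the output receives a limit.
    next-output : ∀ {ψ c} → Valid e i (cnd c) (fin c) → Unavoidable ψ c →
      Σ Mathias λ d → X ⊢ d ⊑ c × Valid e i (cnd d) (fin d) ×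
      Σ ℕ λ x → Out ψ (fin d) x × x < len (cnd d)
    next-output {ψ} {c} va unav = dne λ none → unav c ⊑-refl va (inj₂ (0 , λ q G q≼ E va′ x _ out →
      none (mathias (extend q (suc x) (λ _ → true)) G (bnd c) ,
            ext (≼-trans (extend-≼ q _ _) q≼) (λ _ → ≤-refl) E ,
            Valid-mono e (extend-≼ q _ _) va′ , x , out , extend-len q (suc x) (λ _ → true))))

    -- Consequences of unavoidability after a first output

    module Seeded (inf : Infinite X) (nice : Nice X) (ψ : PR 1) (c : Mathias) (c≼p₀ : cnd c ≼ p₀)
      (unav : Unavoidable ψ c) (x₁ : ℕ) (out₁ : Out ψ (fin c) x₁) (x₁< : x₁ < len (cnd c)) where

      -- The only limit that outputs can have from now on, as an output with the other limit would
      -- be `Bad` together with `x₁`.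
      l : Bool
      l = lim (cnd c) x₁

      Good : Mathias → Set
      Good d = X ⊢ d ⊑ c × Valid e i (cnd d) (fin d)

      B : ℕ → Approx → Set
      B = Big ψ X

      Split : Approx → Bool → Set
      Split F s = ∀ k → Almost X (λ y → Σ ℕ λ x → k ≤ x × B x ((s , y) ∷ F))

      output-limit : ∀ {d x} → Good d → Out ψ (fin d) x → x < len (cnd d) → lim (cnd d) x ≡ l
      output-limit {d} {x} (d⊑c , va) out x< = dne λ ne → unav d d⊑c va (inj₁
        (x , x₁ , out , Out-mono (fin-ext d⊑c) (sorted va) out₁ , x< ,
         <-≤-trans x₁< (len≤ (cnd≼ d⊑c)) , inj₁ λ eq → ne (trans eq (lim≡ (cnd≼ d⊑c) x₁<))))

      follow-good : ∀ {d x} → Good d → B x (fin d) →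
        Σ Mathias λ d′ → Good d′ × X ⊢ d′ ⊑ d × Out ψ (fin d′) x
      follow-good {d} (d⊑c , va) big with follow (bnd d) (≼-trans (cnd≼ d⊑c) c≼p₀) va big
      ... | q , F , q≼ , E , va′ , out =
        mathias q F (bnd d) , (⊑-trans d′⊑d d⊑c , va′) , d′⊑d , out
        where d′⊑d = ext q≼ (λ _ → ≤-refl) E

      big-limit : ∀ {d x} → Good d → B x (fin d) → x < len (cnd d) → lim (cnd d) x ≡ l
      big-limit good big x< with follow-good good big
      ... | d′ , good′ , d′⊑d , out =
        trans (sym (lim≡ (cnd≼ d′⊑d) x<)) (output-limit good′ out (<-≤-trans x< (len≤ (cnd≼ d′⊑d))))

      extend-good : ∀ {d} N g → Good d → Good (mathias (extend (cnd d) N g) (fin d) (bnd d))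
      extend-good {d} N g (ext p k E , va) =
        ext (≼-trans (extend-≼ (cnd d) N g) p) k E , Valid-mono e (extend-≼ (cnd d) N g) va

      -- The limit of `x` is still free: it could be set to `not l`, and following the tree would
      -- then output `x`.
      not-big : ∀ {d x} → Good d → len (cnd d) ≤ x → ¬ B x (fin d)
      not-big {d} {x} good le big = not≢ l
        (trans (sym (extend-lim (cnd d) (suc x) (λ _ → not l) le))
               (big-limit (extend-good (suc x) (λ _ → not l) good) big (extend-len (cnd d) (suc x) (λ _ → not l))))

      -- Otherwise the elements that make `x` big would form the sequence required by `step`.
      not-big-step : ∀ {x G} → ¬ B x G →
        Σ ℕ λ N → ∀ s y → N ≤ y → X y ≡ true → ¬ B x ((s , y) ∷ G)
      not-big-step {x} {G} ¬big = dne λ none →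
        let find : ∀ N → Σ (Bool × ℕ) λ u → N ≤ proj₂ u × X (proj₂ u) ≡ true × B x (u ∷ G)
            find N = dne λ none′ → none (N , λ s y le inX big → none′ ((s , y) , le , inX , big))
        in ¬big (step (λ N → proj₁ (find N)) (λ N → proj₁ (proj₂ (find N)))
                  (λ N → proj₁ (proj₂ (proj₂ (find N)))) (λ N → proj₂ (proj₂ (proj₂ (find N)))))

      ¬Split⇒ : ∀ {F s} → ¬ Split F s →
        Σ ℕ λ k → Almost X (λ y → ∀ x → k ≤ x → ¬ B x ((s , y) ∷ F))
      ¬Split⇒ {F} {s} ¬sp with ¬∀⇒∃¬ ¬sp
      ... | k , ¬al with nice ψ F s k
      ... | inj₁ al = ⊥-elim (¬al al)
      ... | inj₂ al = k , al

      -- Otherwise raising the bounds would silence `ψ`. The invariant is that no `x` from `m` on is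
      -- big. If `G` satisfies it and splits on neither side, niceness takes care of all `x` from
      -- some `k` on, and `not-big-step` of the finitely many others; the maximum of the thresholds
      -- becomes the bound at `G`.
      split-exists : ∀ {d} → Good d → Σ Mathias λ d′ → X ⊢ d′ ⊑ d × Good d′ × Σ Bool (Split (fin d′))
      split-exists {d} good@(d⊑c , va) = dne λ none → unav d″ (d″⊑c) va (inj₂ (m , quiet none))
        where
        m : ℕ
        m = len (cnd d)
        Small : Approx → Set
        Small G = ∀ x → m ≤ x → ¬ B x G
        Barrier : Approx → Set
        Barrier G = Σ ℕ λ N → ∀ s y → N ≤ y → X y ≡ true → Small ((s , y) ∷ G)
        -- Having a barrier does not depend on a condition extending `cnd d`, so the bound function
        -- can be fixed in advance. The default 0 concerns only approximations that no valid
        -- extension reaches.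
        barrier : ∀ G → Dec (Barrier G) → ℕ
        barrier G (yes (N , _)) = N
        barrier G (no _) = 0
        barrier-small : ∀ {G s y} (b? : Dec (Barrier G)) → Barrier G → barrier G b? ≤ y → X y ≡ true →
          Small ((s , y) ∷ G)
        barrier-small {s = s} {y} (yes (_ , f)) _ le inX = f s y le inX
        barrier-small (no ¬b) b = ⊥-elim (¬b b)
        K : Approx → ℕ
        K G = bnd d G ⊔ barrier G em
        d″ : Mathias
        d″ = mathias (cnd d) (fin d) K
        K≤ : ∀ G → bnd d G ≤ K G
        K≤ G = m≤m⊔n _ _
        d″⊑c : X ⊢ d″ ⊑ c
        d″⊑c = ⊑-trans (ext ≼-refl K≤ done) d⊑c
        module _ (none : ¬ Σ Mathias λ d′ → X ⊢ d′ ⊑ d × Good d′ × Σ Bool (Split (fin d′))) where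
          has-barrier : ∀ {q G} → q ≼ cnd d → Ext X K (fin d) G → Valid e i q G → Small G → Barrier G
          has-barrier {q} {G} q≼ E vaG small = assemble (split-fails true) (split-fails false)
            where
            g : Mathias
            g = mathias q G (bnd d)
            g⊑d : X ⊢ g ⊑ d
            g⊑d = ext q≼ (λ _ → ≤-refl) (Ext-mono K≤ E)
            split-fails : ∀ s → Σ ℕ λ k → Almost X (λ y → ∀ x → k ≤ x → ¬ B x ((s , y) ∷ G))
            split-fails s = ¬Split⇒ λ sp → none (g , g⊑d , (⊑-trans g⊑d d⊑c , vaG) , s , sp)
            below : ∀ k → Σ ℕ λ N → ∀ x → x < k → m ≤ x →
              ∀ s y → N ≤ y → X y ≡ true → ¬ B x ((s , y) ∷ G)
            below = max-below (λ x N → m ≤ x → ∀ s y → N ≤ y → X y ≡ true → ¬ B x ((s , y) ∷ G))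
              (λ N≤M f m≤x s y M≤y → f m≤x s y (≤-trans N≤M M≤y)) single
              where
              single : ∀ x → Σ ℕ λ N → m ≤ x → ∀ s y → N ≤ y → X y ≡ true → ¬ B x ((s , y) ∷ G)
              single x with m ≤? x
              ... | yes m≤x with N , f ← not-big-step (small x m≤x) = N , λ _ → f
              ... | no m≰x = 0 , λ m≤x → ⊥-elim (m≰x m≤x)
            assemble : Σ ℕ (λ k → Almost X (λ y → ∀ x → k ≤ x → ¬ B x ((true , y) ∷ G))) →
                       Σ ℕ (λ k → Almost X (λ y → ∀ x → k ≤ x → ¬ B x ((false , y) ∷ G))) → Barrier G
            assemble (k₁ , N₁ , f₁) (k₀ , N₀ , f₀) with below (k₁ ⊔ k₀)
            ... | N , f = N ⊔ (N₁ ⊔ N₀) , go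
              where
              go : ∀ s y → N ⊔ (N₁ ⊔ N₀) ≤ y → X y ≡ true → Small ((s , y) ∷ G)
              go s y le inX x m≤x with x <? k₁ ⊔ k₀
              ... | yes x< = f x x< m≤x s y (≤-trans (m≤m⊔n N _) le) inX
              go true y le inX x m≤x | no x≮ =
                f₁ y (≤-trans (m≤m⊔n N₁ N₀) (≤-trans (m≤n⊔m N _) le)) inX x
                   (≤-trans (m≤m⊔n k₁ k₀) (≮⇒≥ x≮))
              go false y le inX x m≤x | no x≮ =
                f₀ y (≤-trans (m≤n⊔m N₁ N₀) (≤-trans (m≤n⊔m N _) le)) inX x
                   (≤-trans (m≤n⊔m k₁ k₀) (≮⇒≥ x≮))
          small : ∀ {q G} → q ≼ cnd d → Ext X K (fin d) G → Valid e i q G → Small G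
          small q≼ done vaG x m≤x = not-big good m≤x
          small q≼ (add {G} E inX le) vaG =
            barrier-small em (has-barrier q≼ E (Valid-tail e vaG) (small q≼ E (Valid-tail e vaG)))
              (≤-trans (m≤n⊔m (bnd d G) _) le) inX
          quiet : ∀ q G → q ≼ cnd d″ → Ext X K (fin d) G → Valid e i q G → ∀ x → m ≤ x → ¬ Out ψ G x
          quiet q G q≼ E vaG x m≤x out = small q≼ E vaG x m≤x (now out)

      size : Mathias → ℕ
      size d = len (cnd d) ⊔ bound (fin d) ⊔ bnd d (fin d)

      len≤size : ∀ d {y} → size d ≤ y → len (cnd d) ≤ y
      len≤size d le = ≤-trans (m≤m⊔n _ _) (≤-trans (m≤m⊔n _ _) le)

      bound≤size : ∀ d {y} → size d ≤ y → bound (fin d) ≤ y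
      bound≤size d le = ≤-trans (m≤n⊔m (len (cnd d)) _) (≤-trans (m≤m⊔n _ _) le)

      bnd≤size : ∀ d {y} → size d ≤ y → bnd d (fin d) ≤ y
      bnd≤size d le = ≤-trans (m≤n⊔m (len (cnd d) ⊔ bound (fin d)) _) le

      -- With `r` it would be legitimate to add `y`, after which `x` is big over a good
      -- approximation and hence must have the limit `l`.
      forced-limit : ∀ {d s y x r} → Good d → X y ≡ true → size d ≤ y → B x ((s , y) ∷ fin d) →
        r ≼ cnd d → x < len r → Decides e r y i → lim r x ≡ l
      forced-limit {d} {s} {y} {x} {r} (d⊑c , va) inX le big r≼ x< de
        with add-element s (≼-trans (cnd≼ d⊑c) c≼p₀) va (len≤size d le) (bound≤size d le) r≼ de
      ... | r′ , r′≼r , va′ = trans (sym (lim≡ r′≼r x<))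
        (big-limit (⊑-trans d′⊑d d⊑c , va′) big (<-≤-trans x< (len≤ r′≼r)))
        where
        d′⊑d : X ⊢ mathias r′ ((s , y) ∷ fin d) (bnd d) ⊑ d
        d′⊑d = ext (≼-trans r′≼r r≼) (λ _ → ≤-refl) (add done inX (bnd≤size d le))

      -- The converse of `forced-limit`: together they tie the colour of `y` to the limit of `x`. No
      -- side occurs, so a tag found by trying `y` on one side also serves when `y` is put on the
      -- other.
      Tag : Cond → ℕ → ℕ → Set
      Tag q y x = ∀ {r b} → r ≼ q → x < len r → lim r x ≡ l → Decides e r y b → b ≡ i

      Tagging : Set
      Tagging = ∀ d → Good d → ∀ s → Split (fin d) s → ∀ k →
        Almost X (λ y → Σ ℕ λ x → k ≤ x × B x ((s , y) ∷ fin d) × Tag (cnd d) y x)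

      -- Switching the limit of a tag

      module Switch (tagging : Tagging) {d s} (good : Good d) (split : Split (fin d) s)
        {z x} (inz : X z ≡ true) (size≤z : size d ≤ z) (len≤x : len (cnd d) ≤ x)
        (tag-z : Tag (cnd d) z x) where

        tags : Almost X (λ y → Σ ℕ λ x′ → suc x ≤ x′ × B x′ ((s , y) ∷ fin d) × Tag (cnd d) y x′)
        -- These tags lie beyond `x`, so switching the limit of `x` does not touch them. The bound
        -- `K` ensures that every element added after `z` has one.
        tags = tagging d good s split (suc x)

        N : ℕ
        N = proj₁ tags ⊔ size d

        K : Approx → ℕ
        K G = bnd d G ⊔ N

        module _ {g} (E : Ext X K ((s , z) ∷ fin d) (fin g)) (g≼d : cnd g ≼ cnd d)
          (bnd≤g : ∀ G → bnd d G ≤ bnd g G) (good-g : Good g)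
          (out-g : Out ψ (fin g) x) (x<g : x < len (cnd g)) (split-g : Split (fin g) s) where

          IsNew : ℕ → Set
          IsNew a = X a ≡ true × N ≤ a

          class : ∀ {t a} → (t , a) ∈ fin g → (t , a) ∈ fin d ⊎ (t ≡ s × a ≡ z) ⊎ IsNew a
          class u∈ with Ext-∈⁻ (λ H → m≤n⊔m (bnd d H) N) E u∈
          ... | inj₁ (here refl) = inj₂ (inj₁ (refl , refl))
          ... | inj₁ (there u∈d) = inj₁ u∈d
          ... | inj₂ new = inj₂ (inj₂ new)

          Tagged : Cond → ℕ → Set
          Tagged r a = Σ ℕ λ xa → xa < len r × lim r xa ≡ l × Tag (cnd d) a xa

          Tagged⁺ : Cond → ℕ → Set
          Tagged⁺ r a = Σ ℕ λ xa → suc x ≤ xa × xa < len r × lim r xa ≡ l × Tag (cnd d) a xa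

          Tagged⁺-mono : ∀ {r r′ a} → r′ ≼ r → Tagged⁺ r a → Tagged⁺ r′ a
          Tagged⁺-mono r′≼r (xa , le , xa< , eq , tag) =
            xa , le , <-≤-trans xa< (len≤ r′≼r) , trans (lim≡ r′≼r xa<) eq , tag

          Tagged⁺-set : ∀ {r a} b → Tagged⁺ r a → Tagged⁺ (setLim r x b) a
          Tagged⁺-set {r} b (xa , le , xa< , eq , tag) =
            xa , le , xa< , trans (setLim-≢ r x b (λ xa≡x → <⇒≢ le (sym xa≡x))) eq , tag

          Tagged-decides : ∀ {r r′ a} → r ≼ cnd d → r′ ≼ r → Tagged r a →
            Σ Cond λ r″ → r″ ≼ r′ × Decides e r″ a i
          Tagged-decides {r} {r′} {a} r≼ r′≼ (xa , xa< , eq , tag)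
            with deciding r′ (≼-trans r′≼ (≼-trans r≼ (≼-trans (cnd≼ (proj₁ good)) c≼p₀))) a
          ... | r″ , r″≼ , b , de
            with refl ← tag (≼-trans r″≼ (≼-trans r′≼ r≼)) (<-≤-trans xa< (len≤ (≼-trans r″≼ r′≼)))
                         (trans (lim≡ (≼-trans r″≼ r′≼) xa<) eq) de = r″ , r″≼ , de

          Tagged⁺-decides : ∀ {r r′ a} → r ≼ cnd d → r′ ≼ r → Tagged⁺ r a →
            Σ Cond λ r″ → r″ ≼ r′ × Decides e r″ a i
          Tagged⁺-decides r≼ r′≼ (xa , _ , t) = Tagged-decides r≼ r′≼ (xa , t)

          -- The tag of `a` comes from `(s , a) ∷ fin d` whatever the side of `a`. Lengthening the
          -- condition only brings the tag into its domain; that its limit is `l` follows from the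
          -- decision of `a` in `g`.
          stage₀ : Σ Cond λ r → r ≼ cnd g × (∀ u → u ∈ fin g → IsNew (proj₂ u) → Tagged⁺ r (proj₂ u))
          stage₀ = extend-all (λ r u → IsNew (proj₂ u) → Tagged⁺ r (proj₂ u))
            (λ r′≼r t new → Tagged⁺-mono r′≼r (t new)) (fin g) dense (cnd g) ≼-refl
            where
            dense : ∀ u → u ∈ fin g → ∀ r → r ≼ cnd g →
              Σ Cond λ r′ → r′ ≼ r × (IsNew (proj₂ u) → Tagged⁺ r′ (proj₂ u))
            dense (t , a) u∈ r r≼ with em {IsNew a}
            ... | no ¬new = r , ≼-refl , λ new → ⊥-elim (¬new new)
            ... | yes (ina , N≤a) with proj₂ tags a (≤-trans (m≤m⊔n _ _) N≤a) ina
            ... | xa , le , big , tag = r′ , r′≼r , λ _ → xa , le , xa< ,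
                  forced-limit good ina (≤-trans (m≤n⊔m (proj₁ tags) _) N≤a) big
                    (≼-trans r′≼r (≼-trans r≼ g≼d)) xa<
                    (Decides-mono e (≼-trans r′≼r r≼) (decided (proj₂ good-g) u∈)) , tag
              where
              r′ = extend r (suc xa) (λ _ → l)
              r′≼r = extend-≼ r (suc xa) (λ _ → l)
              xa< = extend-len r (suc xa) (λ _ → l)

          r₀ r₁ : Cond
          r₀ = proj₁ stage₀
          -- This still extends `cnd d` but contradicts a promise of `cnd g`: decisions made after
          -- `d` are lost, while forced values remain.
          r₁ = setLim r₀ x (not l)

          r₀≼g : r₀ ≼ cnd g
          r₀≼g = proj₁ (proj₂ stage₀)

          r₁≼d : r₁ ≼ cnd d
          r₁≼d = setLim-≼ x (not l) (≼-trans r₀≼g g≼d) len≤x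

          tagged₁ : ∀ {t a} → (t , a) ∈ fin g → IsNew a → Tagged⁺ r₁ a
          tagged₁ u∈ new = Tagged⁺-set {r₀} (not l) (proj₂ (proj₂ stage₀) _ u∈ new)

          -- The tags of the new elements keep the limit `l`, so the lost decisions can be made
          -- again with colour `i`. The element `z` is left out, its tag being `x`.
          stage₂ : Σ Cond λ r → r ≼ r₁ × (∀ u → u ∈ fin g → IsNew (proj₂ u) → Decides e r (proj₂ u) i)
          stage₂ = extend-all (λ r u → IsNew (proj₂ u) → Decides e r (proj₂ u) i)
            (λ r′≼r de new → Decides-mono e r′≼r (de new)) (fin g) dense r₁ ≼-refl
            where
            dense : ∀ u → u ∈ fin g → ∀ r → r ≼ r₁ →
              Σ Cond λ r′ → r′ ≼ r × (IsNew (proj₂ u) → Decides e r′ (proj₂ u) i)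
            dense (t , a) u∈ r r≼ with em {IsNew a}
            ... | no ¬new = r , ≼-refl , λ new → ⊥-elim (¬new new)
            ... | yes new with Tagged⁺-decides r₁≼d r≼ (tagged₁ u∈ new)
            ... | r′ , r′≼ , de = r′ , r′≼ , λ _ → de

          r₂ : Cond
          r₂ = proj₁ stage₂

          r₂≼r₁ : r₂ ≼ r₁
          r₂≼r₁ = proj₁ (proj₂ stage₂)

          x<r₁ : x < len r₁
          x<r₁ = <-≤-trans x<g (len≤ r₀≼g)

          x<r₂ : x < len r₂
          x<r₂ = <-≤-trans x<r₁ (len≤ r₂≼r₁)

          lim₂ : lim r₂ x ≡ not l
          lim₂ = trans (lim≡ r₂≼r₁ x<r₁) (setLim-≡ r₀ x (not l))

          split₂ : Almost X (λ y → Σ ℕ λ x′ → len r₂ ≤ x′ × B x′ ((s , y) ∷ fin g))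
          split₂ = split-g (len r₂)

          tags₂ : Almost X (λ y → Σ ℕ λ x′ → len r₂ ≤ x′ × B x′ ((s , y) ∷ fin d) × Tag (cnd d) y x′)
          tags₂ = tagging d good s split (len r₂)

          M : ℕ
          M = proj₁ split₂ ⊔ proj₁ tags₂ ⊔ len r₂ ⊔ size g ⊔ size d

          -- Two numbers come with `u`. The one to be output is `x₂`, big over `fin g`; `xu`, big
          -- over `fin d`, is the tag of `u`. The tag must come from `d`, since the conditions used
          -- here extend `cnd d` but not `cnd g`.
          contradiction : ∀ {u x₂ xu r₃} → X u ≡ true → size g ≤ u → size d ≤ u → len r₂ ≤ u →
            len r₂ ≤ x₂ → B x₂ ((s , u) ∷ fin g) →
            len r₂ ≤ xu → B xu ((s , u) ∷ fin d) → Tag (cnd d) u xu →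
            r₃ ≼ r₂ → Decides e r₃ u i → ⊥
          contradiction {u} {x₂} {xu} {r₃} inu g≤u d≤u r₂≤u r₂≤x₂ big₂ r₂≤xu big-u tag-u r₃≼r₂ de-u =
            finish (extend-all (λ r v → Decides e r (proj₂ v) i) (Decides-mono e) ((s , u) ∷ fin g)
                     decide r₅ ≼-refl)
            where
            r₃′ : Cond
            r₃′ = extend r₃ (suc (x₂ ⊔ xu)) (λ _ → l)
            r₃′≼r₃ : r₃′ ≼ r₃
            r₃′≼r₃ = extend-≼ r₃ (suc (x₂ ⊔ xu)) (λ _ → l)
            r₃′≼r₂ : r₃′ ≼ r₂
            r₃′≼r₂ = ≼-trans r₃′≼r₃ r₃≼r₂
            r₂≼d : r₂ ≼ cnd d
            r₂≼d = ≼-trans r₂≼r₁ r₁≼d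
            d≼p₀ : cnd d ≼ p₀
            d≼p₀ = ≼-trans (cnd≼ (proj₁ good)) c≼p₀
            column : Σ Cond λ r → r ≼ r₃′ × (∀ {t a} → (t , a) ∈ fin g → t ≢ s → Forces e r a u i)
            column = force-column s u (fin g) (≼-trans r₃′≼r₂ (≼-trans r₂≼d d≼p₀)) source
              where
              source : ∀ {t a} → (t , a) ∈ fin g → t ≢ s →
                Σ Cond λ q → r₃′ ≼ q × Decides e q a i × len q ≤ u
              source u∈ t≢s with class u∈
              ... | inj₁ u∈d = cnd d , ≼-trans r₃′≼r₂ r₂≼d , decided (proj₂ good) u∈d , len≤size d d≤u
              ... | inj₂ (inj₁ (t≡s , _)) = ⊥-elim (t≢s t≡s)
              ... | inj₂ (inj₂ new) = r₂ , r₃′≼r₂ , proj₂ (proj₂ stage₂) _ u∈ new , r₂≤u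
            r₄ r₅ : Cond
            r₄ = proj₁ column
            r₅ = setLim r₄ x l
            r₄≼r₃′ : r₄ ≼ r₃′
            r₄≼r₃′ = proj₁ (proj₂ column)
            r₄≼r₂ : r₄ ≼ r₂
            r₄≼r₂ = ≼-trans r₄≼r₃′ r₃′≼r₂
            r₄≼d : r₄ ≼ cnd d
            r₄≼d = ≼-trans r₄≼r₂ r₂≼d
            r₅≼d : r₅ ≼ cnd d
            r₅≼d = setLim-≼ x l r₄≼d len≤x
            below₄ : suc (x₂ ⊔ xu) ≤ len r₄
            below₄ = ≤-trans (extend-len r₃ (suc (x₂ ⊔ xu)) (λ _ → l)) (len≤ r₄≼r₃′)
            x₂<r₄ : x₂ < len r₄
            x₂<r₄ = ≤-trans (s≤s (m≤m⊔n x₂ xu)) below₄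
            xu<r₄ : xu < len r₄
            xu<r₄ = ≤-trans (s≤s (m≤n⊔m x₂ xu)) below₄
            x<r₄ : x < len r₄
            x<r₄ = <-≤-trans x<r₂ (len≤ r₄≼r₂)
            x<xu : x < xu
            x<xu = <-≤-trans x<r₂ r₂≤xu
            lim-xu : lim r₅ xu ≡ l
            lim-xu = trans (setLim-≢ r₄ x l (λ eq → <⇒≢ x<xu (sym eq)))
              (forced-limit good inu d≤u big-u r₄≼d xu<r₄ (Decides-mono e (≼-trans r₄≼r₃′ r₃′≼r₃) de-u))
            tagged₅ : ∀ {t a} → (t , a) ∈ fin g → IsNew a → Tagged⁺ r₅ a
            tagged₅ u∈ new =
              Tagged⁺-set {r₄} l (Tagged⁺-mono (≼-trans r₄≼r₂ r₂≼r₁) (tagged₁ u∈ new))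
            decide : ∀ v → v ∈ ((s , u) ∷ fin g) → ∀ r → r ≼ r₅ →
              Σ Cond λ r′ → r′ ≼ r × Decides e r′ (proj₂ v) i
            decide _ (here refl) r r≼ = Tagged-decides r₅≼d r≼ (xu , xu<r₄ , lim-xu , tag-u)
            decide (t , a) (there u∈) r r≼ = by-class (class u∈)
              where
              by-class : (t , a) ∈ fin d ⊎ (t ≡ s × a ≡ z) ⊎ IsNew a →
                Σ Cond λ r′ → r′ ≼ r × Decides e r′ a i
              by-class (inj₁ u∈d) =
                r , ≼-refl , Decides-mono e (≼-trans r≼ r₅≼d) (decided (proj₂ good) u∈d)
              by-class (inj₂ (inj₁ (_ , refl))) =
                Tagged-decides r₅≼d r≼ (x , x<r₄ , setLim-≡ r₄ x l , tag-z)
              by-class (inj₂ (inj₂ new)) = Tagged⁺-decides r₅≼d r≼ (tagged₅ u∈ new)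
            finish : ¬ Σ Cond λ r → r ≼ r₅ × (∀ v → v ∈ ((s , u) ∷ fin g) → Decides e r (proj₂ v) i)
            finish (r₆ , r₆≼r₅ , de₆) = conclude (follow-good good₆ big₂)
              where
              lift : ∀ {a y v} → Forces e (cnd g) a y v → Forces e r₆ a y v
              -- `Forces` reads only `len` and `val`, so forcing at `r₀` is literally forcing at
              -- `r₁`, and likewise for `r₄` and `r₅`.
              lift {a} {y} {v} fo = Forces-mono e {v = v} r₆≼r₅
                (Forces-mono e {v = v} (≼-trans r₄≼r₂ r₂≼r₁) (Forces-mono e {v = v} r₀≼g fo))
              g₆ : Mathias
              g₆ = mathias r₆ ((s , u) ∷ fin g) (bnd d)
              last : Ext X (bnd d) (fin g) ((s , u) ∷ fin g)
              last = add done inu (≤-trans (bnd≤g (fin g)) (bnd≤size g g≤u))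
              -- Goodness is derived through `d`, as `r₆` breaks the promise of `cnd g` about `x`.
              good₆ : Good g₆
              good₆ = ⊑-trans (ext (≼-trans r₆≼r₅ r₅≼d) (λ _ → ≤-refl)
                  (Ext-trans (add done inz (bnd≤size d size≤z))
                    (Ext-trans (Ext-mono (λ G → m≤m⊔n (bnd d G) N) E) last))) (proj₁ good) ,
                valid (sorted (proj₂ good-g) , bound≤size g g≤u)
                  (Pairs-map e lift (fin g) (pairs (proj₂ good-g)) ,
                   λ u∈ t≢s → Forces-mono e r₆≼r₅ (proj₂ (proj₂ column) u∈ t≢s))
                  (λ u∈ → de₆ _ u∈)
              conclude : ¬ Σ Mathias λ g₇ → Good g₇ × X ⊢ g₇ ⊑ g₆ × Out ψ (fin g₇) x₂
              conclude (g₇ , good₇ , g₇⊑g₆ , out₂) = unav g₇ (proj₁ good₇) (proj₂ good₇) (inj₁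
                ( x , x₂ , Out-mono (Ext-trans last (fin-ext g₇⊑g₆)) (sorted (proj₂ good₇)) out-g , out₂
                , <-≤-trans x<r₄ (len≤ g₇≼r₅) , <-≤-trans x₂<r₄ (len≤ g₇≼r₅)
                , inj₂ (<-≤-trans x<r₂ r₂≤x₂ , λ eq → not≢ l (trans (sym val₇) (trans eq lim₇)))))
                where
                g₇≼r₅ : cnd g₇ ≼ r₅
                g₇≼r₅ = ≼-trans (cnd≼ g₇⊑g₆) r₆≼r₅
                -- `x₂` entered the condition while the limit of `x` was `not l`.
                val₇ : val (cnd g₇) x x₂ ≡ not l
                val₇ = trans (val≡ g₇≼r₅ x<r₄ x₂<r₄) (trans (new r₄≼r₂ x<r₂ r₂≤x₂ x₂<r₄) lim₂)
                lim₇ : lim (cnd g₇) x ≡ l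
                lim₇ = trans (lim≡ g₇≼r₅ x<r₄) (setLim-≡ r₄ x l)

          absurd : ⊥
          absurd = choose-u (rich-sequence (≼-trans r₂≼r₁ (≼-trans r₁≼d (≼-trans (cnd≼ (proj₁ good)) c≼p₀)))
            (λ k → proj₁ (inf k)) (λ k → proj₁ (proj₂ (inf k))) (λ k → proj₂ (proj₂ (inf k))) M)
            where
            above : ∀ {u r₃} → M ≤ u → X u ≡ true → r₃ ≼ r₂ → Decides e r₃ u i → ⊥
            above {u} M≤u inu r₃≼r₂ de-u
              with m₁ , d≤u ← ⊔-≤ M≤u
              with m₂ , g≤u ← ⊔-≤ m₁
              with m₃ , r₂≤u ← ⊔-≤ m₂
              with s≤u , t≤u ← ⊔-≤ m₃ =
              contradiction inu g≤u d≤u r₂≤u (proj₁ (proj₂ big₂)) (proj₂ (proj₂ big₂))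
                (proj₁ (proj₂ tag₂)) (proj₁ (proj₂ (proj₂ tag₂))) (proj₂ (proj₂ (proj₂ tag₂))) r₃≼r₂ de-u
              where
              big₂ = proj₂ split₂ u s≤u inu
              tag₂ = proj₂ tags₂ u t≤u inu
            choose-u : ¬ Σ ℕ λ k → M ≤ k × Σ Cond λ r → r ≼ r₂ × Decides e r (proj₁ (inf k)) i
            choose-u (k , M≤k , r₃ , r₃≼r₂ , de-u) =
              above (≤-trans M≤k (proj₁ (proj₂ (inf k)))) (proj₂ (proj₂ (inf k))) r₃≼r₂ de-u

      -- While the limit of x is switched, z loses its colour; this does no harm to u only
      -- because p-homogeneity ignores pairs on the same side.
      split-ends : Tagging → ∀ {d s} → Good d → Split (fin d) s →
        Σ Mathias λ d′ → X ⊢ d′ ⊑ d × Good d′ × (∀ g → X ⊢ g ⊑ d′ → Good g → ¬ Split (fin g) s)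
      split-ends tagging {d} {s} good split = choose-z (tagging d good s split (len (cnd d)))
        where
        Goal : Set
        Goal = Σ Mathias λ d′ → X ⊢ d′ ⊑ d × Good d′ × (∀ g → X ⊢ g ⊑ d′ → Good g → ¬ Split (fin g) s)
        d≼p₀ : cnd d ≼ p₀
        d≼p₀ = ≼-trans (cnd≼ (proj₁ good)) c≼p₀
        module At {z x} (inz : X z ≡ true) (size≤z : size d ≤ z) (len≤x : len (cnd d) ≤ x)
          (big : B x ((s , z) ∷ fin d)) (tag : Tag (cnd d) z x) where
          module Sw = Switch tagging good split inz size≤z len≤x tag
          q₁ : Cond
          q₁ = extend (cnd d) (suc x) (λ _ → l)
          q₁≼d : q₁ ≼ cnd d
          q₁≼d = extend-≼ (cnd d) (suc x) (λ _ → l)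
          x<q₁ : x < len q₁
          x<q₁ = extend-len (cnd d) (suc x) (λ _ → l)
          K≥ : ∀ G → bnd d G ≤ Sw.K G
          K≥ G = m≤m⊔n (bnd d G) Sw.N
          conclude : ∀ {q₃} → q₃ ≼ q₁ →
            (Σ Cond λ q₄ → Σ Approx λ F → q₄ ≼ q₃ × Ext X Sw.K ((s , z) ∷ fin d) F ×
              Valid e i q₄ F × Out ψ F x) → Goal
          conclude q₃≼q₁ (q₄ , F , q₄≼q₃ , E , va , out) =
            d′ , d′⊑d , (⊑-trans d′⊑d (proj₁ good) , va) , ends
            where
            d′ : Mathias
            d′ = mathias q₄ F Sw.K
            d′⊑d : X ⊢ d′ ⊑ d
            d′⊑d = ext (≼-trans q₄≼q₃ (≼-trans q₃≼q₁ q₁≼d)) K≥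
              (Ext-trans (add done inz (bnd≤size d size≤z)) (Ext-mono K≥ E))
            ends : ∀ g → X ⊢ g ⊑ d′ → Good g → ¬ Split (fin g) s
            ends g g⊑d′ good-g = Sw.absurd (Ext-trans E (fin-ext g⊑d′)) (cnd≼ (⊑-trans g⊑d′ d′⊑d))
              (bnd≤ (⊑-trans g⊑d′ d′⊑d)) good-g (Out-mono (fin-ext g⊑d′) (sorted (proj₂ good-g)) out)
              (<-≤-trans x<q₁ (len≤ (≼-trans (cnd≼ g⊑d′) (≼-trans q₄≼q₃ q₃≼q₁))))
          added : ∀ {q₂} → q₂ ≼ q₁ →
            Σ Cond (λ q₃ → q₃ ≼ q₂ × Valid e i q₃ ((s , z) ∷ fin d)) → Goal
          added q₂≼q₁ (q₃ , q₃≼q₂ , va) = conclude (≼-trans q₃≼q₂ q₂≼q₁)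
            (follow Sw.K (≼-trans q₃≼q₂ (≼-trans q₂≼q₁ (≼-trans q₁≼d d≼p₀))) va big)
          decide-z : Σ Cond (λ q₂ → q₂ ≼ q₁ × Σ Bool (Decides e q₂ z)) → Goal
          decide-z (q₂ , q₂≼q₁ , b , de)
            with refl ← tag (≼-trans q₂≼q₁ q₁≼d) (<-≤-trans x<q₁ (len≤ q₂≼q₁))
                          (trans (lim≡ q₂≼q₁ x<q₁) (extend-lim (cnd d) (suc x) (λ _ → l) len≤x)) de =
            added q₂≼q₁ (add-element s d≼p₀ (proj₂ good) (len≤size d size≤z)
              (bound≤size d size≤z) (≼-trans q₂≼q₁ q₁≼d) de)
          result : Goal
          result = decide-z (deciding q₁ (≼-trans q₁≼d d≼p₀) z)
        choose-z : Almost X (λ y → Σ ℕ λ x → len (cnd d) ≤ x × B x ((s , y) ∷ fin d) × Tag (cnd d) y x) → Goal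
        choose-z (N , tags) with inf (N ⊔ size d)
        ... | z , z≥ , inz with tags z (proj₁ (⊔-≤ z≥)) inz
        ... | x , len≤x , big , tag = At.result inz (proj₂ (⊔-≤ {N} z≥)) len≤x big tag

      -- A side on which splitting has been ended stays ended, yet every good approximation has a
      -- good extension that splits on some side. After two endings no side is left.
      tagging-absurd : Tagging → Valid e i (cnd c) (fin c) → ⊥
      tagging-absurd tagging va
        with d₁ , _ , good₁ , s₁ , split₁ ← split-exists (⊑-refl , va)
        with d₂ , _ , good₂ , ends₂ ← split-ends tagging good₁ split₁
        with d₃ , d₃⊑d₂ , good₃ , s₃ , split₃ ← split-exists good₂
        with d₄ , d₄⊑d₃ , good₄ , ends₄ ← split-ends tagging good₃ split₃
        with d₅ , d₅⊑d₄ , good₅ , s₅ , split₅ ← split-exists good₄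
        with d₅⊑d₂ ← ⊑-trans d₅⊑d₄ (⊑-trans d₄⊑d₃ d₃⊑d₂) =
        ends₄ d₅ d₅⊑d₄ good₅ (subst (Split (fin d₅)) (sym (bool-pigeonhole s₁≢s₃ s₁≢s₅)) split₅)
        where
        s₁≢s₃ : s₁ ≢ s₃
        s₁≢s₃ refl = ends₂ d₃ d₃⊑d₂ good₃ split₃
        s₁≢s₅ : s₁ ≢ s₅
        s₁≢s₅ refl = ends₂ d₅ d₅⊑d₂ good₅ split₅

-- Choosing the colour and the reservoir

module Existence (em : ExcludedMiddle 0ℓ) where
  open Classical em
  open Core em

  module TwoColours (e : PR 2) (X : Subset) (inf : Infinite X) (nice : Nice X) (p₀ : Cond)
    (convergent : Convergent e p₀) (deciding : Deciding e p₀) (i : Bool)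
    (rich : Rich e i X p₀) (rich′ : Rich e (not i) X p₀) where

    module C  = Colour e X p₀ convergent deciding i rich
    module C′ = Colour e X p₀ convergent deciding (not i) rich′

    module Tagged {ψ c x₁} (c≼p₀ : cnd c ≼ p₀) (unav : C.Unavoidable ψ c)
      (out₁ : Out ψ (fin c) x₁) (x₁< : x₁ < len (cnd c))
      {ψ′ c′ x₁′} (c′≼p₀ : cnd c′ ≼ p₀) (unav′ : C′.Unavoidable ψ′ c′)
      (out₁′ : Out ψ′ (fin c′) x₁′) (x₁′< : x₁′ < len (cnd c′)) where

      module S  = C.Seeded inf nice ψ c c≼p₀ unav x₁ out₁ x₁<
      module S′ = C′.Seeded inf nice ψ′ c′ c′≼p₀ unav′ x₁′ out₁′ x₁′<

      -- Under both colours, deciding y fixes the limit of the number that adding y makes big;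
      -- as the limits are free, both colours must refer to the same number, with opposite limits.
      tag : ∀ {d d′ s s′ y x x′} → cnd d′ ≡ cnd d → S.Good d → S′.Good d′ → X y ≡ true →
        S.size d ≤ y → S′.size d′ ≤ y →
        len (cnd d) ≤ x → S.B x ((s , y) ∷ fin d) → len (cnd d) ≤ x′ → S′.B x′ ((s′ , y) ∷ fin d′) →
        S.Tag (cnd d) y x
      tag {d} {d′} {y = y} {x} {x′} refl good good′ iny le le′ d≤x big d≤x′ big′ {r} {b} r≼d x< eq de
        with b Bool.≟ i
      ... | yes b≡i = b≡i
      ... | no b≢i = ⊥-elim (not≢ S.l (trans (sym opposite) (trans (sym lim-x′) eq)))
        where
        alternative : ∀ q → q ≼ cnd d → x < len q → x′ < len q → lim q x ≡ S.l ⊎ lim q x′ ≡ S′.l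
        alternative q q≼ x<q x′<q with deciding q (≼-trans q≼ (≼-trans (cnd≼ (proj₁ good)) c≼p₀)) y
        ... | q′ , q′≼q , a , de′ with a Bool.≟ i
        ... | yes refl = inj₁ (trans (sym (lim≡ q′≼q x<q))
                (S.forced-limit good iny le big (≼-trans q′≼q q≼) (<-≤-trans x<q (len≤ q′≼q)) de′))
        ... | no a≢i with refl ← ¬-not a≢i = inj₂ (trans (sym (lim≡ q′≼q x′<q))
                (S′.forced-limit good′ iny le′ big′ (≼-trans q′≼q q≼) (<-≤-trans x′<q (len≤ q′≼q)) de′))
        free : ∀ (f : ℕ → Bool) → f x ≡ S.l ⊎ f x′ ≡ S′.l
        free f with alternative (extend (cnd d) (suc (x ⊔ x′)) f) (extend-≼ (cnd d) _ f)
                      (≤-trans (s≤s (m≤m⊔n x x′)) (extend-len (cnd d) (suc (x ⊔ x′)) f))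
                      (≤-trans (s≤s (m≤n⊔m x x′)) (extend-len (cnd d) (suc (x ⊔ x′)) f))
        ... | inj₁ eq₁ = inj₁ (trans (sym (extend-lim (cnd d) (suc (x ⊔ x′)) f d≤x)) eq₁)
        ... | inj₂ eq₂ = inj₂ (trans (sym (extend-lim (cnd d) (suc (x ⊔ x′)) f d≤x′)) eq₂)
        opposite : S′.l ≡ not S.l
        opposite with free (λ _ → not S.l)
        ... | inj₁ eq₁ = ⊥-elim (not≢ S.l eq₁)
        ... | inj₂ eq₂ = sym eq₂
        same : x ≡ x′
        same with x′ ≟ x
        ... | yes eq′ = sym eq′
        ... | no x′≢x with free (λ n → choose (n ≟ x) (not S.l) (not S′.l))
        ... | inj₁ eq₁ = ⊥-elim (not≢ S.l (trans (sym (choose-yes (x ≟ x) refl)) eq₁))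
        ... | inj₂ eq₂ = ⊥-elim (not≢ S′.l (trans (sym (choose-no (x′ ≟ x) x′≢x)) eq₂))
        lim-x′ : lim r x ≡ S′.l
        lim-x′ = subst (λ n → lim r n ≡ S′.l) (sym same)
          (S′.forced-limit good′ iny le′ big′ r≼d (subst (_< len r) same x<)
            (subst (Decides e r y) (¬-not b≢i) de))

      -- The splitting of `fin d₁` for the opposite colour survives under every later condition,
      -- since bigness mentions none. So almost every `y` comes with a number for each colour over
      -- the same condition, as `tag` requires.
      tagging : ∀ {d₁ s₁} → S′.Good d₁ → S′.Split (fin d₁) s₁ → cnd c ≼ cnd d₁ → S.Tagging
      tagging {d₁} good₁ split₁ c≼d₁ d good s split k = combine (split (k ⊔ len (cnd d))) (split₁ (len (cnd d)))
        where
        d′ : Mathias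
        d′ = mathias (cnd d) (fin d₁) (bnd d₁)
        d≼d₁ : cnd d ≼ cnd d₁
        d≼d₁ = ≼-trans (cnd≼ (proj₁ good)) c≼d₁
        good′ : S′.Good d′
        good′ = ⊑-trans (ext d≼d₁ (λ _ → ≤-refl) done) (proj₁ good₁) , Valid-mono e d≼d₁ (proj₂ good₁)
        combine : Almost X (λ y → Σ ℕ λ x → k ⊔ len (cnd d) ≤ x × S.B x ((s , y) ∷ fin d)) →
                  Almost X (λ y → Σ ℕ λ x → len (cnd d) ≤ x × S′.B x ((_ , y) ∷ fin d₁)) →
                  Almost X (λ y → Σ ℕ λ x → k ≤ x × S.B x ((s , y) ∷ fin d) × S.Tag (cnd d) y x)
        combine (N , f) (N′ , f′) = (N ⊔ N′) ⊔ (S.size d ⊔ S′.size d′) , go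
          where
          go : ∀ y → (N ⊔ N′) ⊔ (S.size d ⊔ S′.size d′) ≤ y → X y ≡ true →
            Σ ℕ λ x → k ≤ x × S.B x ((s , y) ∷ fin d) × S.Tag (cnd d) y x
          go y le iny =
            at (f y (proj₁ (⊔-≤ (proj₁ both))) iny) (f′ y (proj₂ (⊔-≤ {N} (proj₁ both))) iny)
            where
            both : N ⊔ N′ ≤ y × S.size d ⊔ S′.size d′ ≤ y
            both = ⊔-≤ le
            at : Σ ℕ (λ x → k ⊔ len (cnd d) ≤ x × S.B x ((s , y) ∷ fin d)) →
                 Σ ℕ (λ x → len (cnd d) ≤ x × S′.B x ((_ , y) ∷ fin d₁)) →
                 Σ ℕ λ x → k ≤ x × S.B x ((s , y) ∷ fin d) × S.Tag (cnd d) y x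
            at (x , x≥ , big) (x′ , x′≥ , big′) = x , proj₁ (⊔-≤ x≥) , big ,
              λ {r} {b} → tag {d} {d′} refl good good′ iny (proj₁ (⊔-≤ (proj₂ both)))
                (proj₂ (⊔-≤ {S.size d} (proj₂ both))) (proj₂ (⊔-≤ {k} x≥)) big x′≥ big′ {r} {b}

    not-both-unavoidable : ∀ {ψ c ψ′ c′} → cnd c ≼ p₀ → Valid e i (cnd c) (fin c) → C.Unavoidable ψ c →
      cnd c′ ≼ p₀ → Valid e (not i) (cnd c′) (fin c′) → C′.Unavoidable ψ′ c′ → cnd c ≼ cnd c′ → ⊥
    not-both-unavoidable {ψ} {c} {ψ′} {c′} c≼ va unav c′≼ va′ unav′ c≼c′ =
      main (C′.next-output at-c (λ g g⊑ → unav′ g (⊑-trans g⊑ b⊑c′)))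
      where
      b : Mathias
      b = mathias (cnd c) (fin c′) (bnd c′)
      b⊑c′ : X ⊢ b ⊑ c′
      b⊑c′ = ext c≼c′ (λ _ → ≤-refl) done
      at-c : Valid e (not i) (cnd c) (fin c′)
      at-c = Valid-mono e c≼c′ va′
      main : ¬ Σ Mathias λ d → X ⊢ d ⊑ b × Valid e (not i) (cnd d) (fin d) ×
               Σ ℕ λ x → Out ψ′ (fin d) x × x < len (cnd d)
      main (d , d⊑b , va-d , x , out , x<) = splitting (S₁.split-exists (⊑-refl , va-d))
        where
        unav-d : C′.Unavoidable ψ′ d
        unav-d g g⊑ = unav′ g (⊑-trans g⊑ (⊑-trans d⊑b b⊑c′))
        d≼p₀ : cnd d ≼ p₀
        d≼p₀ = ≼-trans (cnd≼ d⊑b) c≼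
        module S₁ = C′.Seeded inf nice ψ′ d d≼p₀ unav-d x out x<
        splitting : ¬ Σ Mathias λ d₁ → X ⊢ d₁ ⊑ d × S₁.Good d₁ × Σ Bool (S₁.Split (fin d₁))
        splitting (d₁ , d₁⊑d , good₁ , s₁ , split₁) =
          seeded (C.next-output (Valid-mono e d₁≼c va) (λ g g⊑ → unav g (⊑-trans g⊑ a⊑c)))
          where
          d₁≼c : cnd d₁ ≼ cnd c
          d₁≼c = ≼-trans (cnd≼ d₁⊑d) (cnd≼ d⊑b)
          a : Mathias
          a = mathias (cnd d₁) (fin c) (bnd c)
          a⊑c : X ⊢ a ⊑ c
          a⊑c = ext d₁≼c (λ _ → ≤-refl) done
          seeded : ¬ Σ Mathias λ g → X ⊢ g ⊑ a × Valid e i (cnd g) (fin g) ×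
                     Σ ℕ λ x → Out ψ (fin g) x × x < len (cnd g)
          seeded (g , g⊑a , va-g , y , out-y , y<) =
            T.S.tagging-absurd (T.tagging good₁ split₁ (cnd≼ g⊑a)) va-g
            where
            module T = Tagged {ψ} {g} (≼-trans (cnd≼ g⊑a) (≼-trans d₁≼c c≼))
              (λ h h⊑ → unav h (⊑-trans h⊑ (⊑-trans g⊑a a⊑c))) out-y y< {ψ′} {d} d≼p₀ unav-d out x<

  Avoidable : PR 2 → Bool → Subset → Cond → Set
  Avoidable e i X p = ∀ ((ψ , c) : PR 1 × Mathias) → cnd c ≼ p × Valid e i (cnd c) (fin c) →
    Σ Mathias λ d → X ⊢ d ⊑ c × Valid e i (cnd d) (fin d) × Avoids ψ e i X d

  record Runnable (e : PR 2) (i : Bool) (X : Subset) (p : Cond) : Set where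
    field
      infinite : Infinite X
      richness : Rich e i X p
      convergence : Convergent e p
      decision : Deciding e p
      avoidable : Avoidable e i X p
  open Runnable public

  Runnable-mono : ∀ {e i X p q} → q ≼ p → Runnable e i X p → Runnable e i X q
  Runnable-mono q≼p ru = record
    { infinite = infinite ru
    ; richness = λ r r≼ → richness ru r (≼-trans r≼ q≼p)
    ; convergence = λ r r≼ → convergence ru r (≼-trans r≼ q≼p)
    ; decision = λ r r≼ → decision ru r (≼-trans r≼ q≼p)
    ; avoidable = λ ψc (c≼ , va) → avoidable ru ψc (≼-trans c≼ q≼p , va) }

  unavoidable : ∀ {e i X p} → ¬ Avoidable e i X p → Σ (PR 1) λ ψ → Σ Mathias λ c →
    cnd c ≼ p × Valid e i (cnd c) (fin c) ×
    (∀ d → X ⊢ d ⊑ c → Valid e i (cnd d) (fin d) → ¬ Avoids ψ e i X d)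
  unavoidable ¬av with ¬∀⇒∃¬ ¬av
  ... | (ψ , c) , ¬imp = ψ , c , dne (λ ¬hyp → ¬imp λ hyp → ⊥-elim (¬hyp hyp)) .proj₁ ,
    dne (λ ¬hyp → ¬imp λ hyp → ⊥-elim (¬hyp hyp)) .proj₂ ,
    λ d d⊑c va avoids → ¬imp λ _ → d , d⊑c , va , avoids

  -- When only `j` can be decided, richness for `j` is immediate from `Deciding`, and every number
  -- is a tag.
  one-colour : ∀ {e X p} → Infinite X → Nice X → Convergent e p → Deciding e p → ∀ j →
    (∀ r → r ≼ p → ∀ y → X y ≡ true → ¬ Decides e r y (not j)) → Runnable e j X p
  one-colour {e} {X} {p} inf nice conv deci j never = record
    { infinite = inf ; richness = rich ; convergence = conv ; decision = deci
    ; avoidable = dne λ ¬av → refute (unavoidable ¬av) }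
    where
    only : ∀ {r y b} → r ≼ p → X y ≡ true → Decides e r y b → b ≡ j
    only {r} {y} {b} r≼p iny de with b Bool.≟ j
    ... | yes eq = eq
    ... | no ne with refl ← ¬-not ne = ⊥-elim (never r r≼p y iny de)
    rich : Rich e j X p
    rich q q≼p Y Y⊆X Y-inf with Y-inf 0
    ... | y , _ , iny with deci q q≼p y
    ... | r , r≼q , b , de with refl ← only (≼-trans r≼q q≼p) (Y⊆X iny) de = y , iny , r , r≼q , de
    module C = Colour e X p conv deci j rich
    refute : ¬ Σ (PR 1) λ ψ → Σ Mathias λ c → cnd c ≼ p × Valid e j (cnd c) (fin c) × C.Unavoidable ψ c
    refute (ψ , c , c≼p , va , unav) = seeded (C.next-output va unav)
      where
      seeded : ¬ Σ Mathias λ g → X ⊢ g ⊑ c × Valid e j (cnd g) (fin g) ×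
                 Σ ℕ λ x → Out ψ (fin g) x × x < len (cnd g)
      seeded (g , g⊑c , va-g , x , out , x<) = S.tagging-absurd tagging va-g
        where
        g≼p = ≼-trans (cnd≼ g⊑c) c≼p
        module S = C.Seeded inf nice ψ g g≼p (λ h h⊑ → unav h (⊑-trans h⊑ g⊑c)) x out x<
        tagging : S.Tagging
        tagging d good s split k with split k
        ... | N , f = N , λ y le iny → add-tag iny (f y le iny)
          where
          add-tag : ∀ {y} → X y ≡ true → Σ ℕ (λ x → k ≤ x × S.B x ((s , y) ∷ fin d)) →
            Σ ℕ λ x → k ≤ x × S.B x ((s , y) ∷ fin d) × S.Tag (cnd d) y x
          add-tag iny (x , le , big) = x , le , big ,
            λ r≼ _ _ → only (≼-trans r≼ (≼-trans (cnd≼ (proj₁ good)) g≼p)) iny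

  -- If no reservoir is one-sided below `p`, both colours are rich on `X`. Should the colour `true`
  -- fail at some `c′`, then `false` works below the condition of `c′`, where a second failure would
  -- meet the first.
  runnable-exists : ∀ e p → Convergent e p → Deciding e p →
    Σ Cond λ q → q ≼ p × Σ Bool λ i → Σ Subset λ X → Runnable e i X q
  runnable-exists e p conv deci with nice-exists
  ... | X , inf , robust , nice = decide em
    where
    OneSided : Set
    OneSided = Σ Bool λ j → Σ Cond λ q → q ≼ p × Σ Subset λ Y → Y ⊆ X × Infinite Y ×
      (∀ r → r ≼ q → ∀ y → Y y ≡ true → ¬ Decides e r y (not j))
    Goal : Set
    Goal = Σ Cond λ q → q ≼ p × Σ Bool λ i → Σ Subset λ X → Runnable e i X q
    decide : Dec OneSided → Goal
    decide (yes (j , q , q≼p , Y , Y⊆X , Y-inf , never)) = q , q≼p , j , Y ,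
      one-colour Y-inf (Nice-⊆ robust nice Y⊆X Y-inf) (λ r r≼ → conv r (≼-trans r≼ q≼p))
        (λ r r≼ → deci r (≼-trans r≼ q≼p)) j never
    decide (no two-sided) = try em
      where
      rich-not : ∀ j → Rich e (not j) X p
      rich-not j q q≼p Y Y⊆X Y-inf = dne λ none → two-sided (j , q , q≼p , Y , Y⊆X , Y-inf ,
        λ r r≼q y iny de → none (y , iny , r , r≼q , de))
      runnable : ∀ j q → q ≼ p → Avoidable e (not j) X q → Runnable e (not j) X q
      runnable j q q≼p av = record
        { infinite = inf ; richness = λ r r≼ → rich-not j r (≼-trans r≼ q≼p)
        ; convergence = λ r r≼ → conv r (≼-trans r≼ q≼p)
        ; decision = λ r r≼ → deci r (≼-trans r≼ q≼p) ; avoidable = av }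
      try : Dec (Avoidable e true X p) → Goal
      try (yes av) = p , ≼-refl , true , X , runnable false p ≼-refl av
      try (no ¬av) with unavoidable ¬av
      ... | ψ′ , c′ , c′≼p , va′ , unav′ = cnd c′ , c′≼p , false , X , runnable true (cnd c′) c′≼p
        (dne λ ¬av₀ → refute (unavoidable ¬av₀))
        where
        module T = TwoColours e X inf nice p conv deci false (rich-not true) (rich-not false)
        refute : ¬ Σ (PR 1) λ ψ → Σ Mathias λ c → cnd c ≼ cnd c′ × Valid e false (cnd c) (fin c) ×
          T.C.Unavoidable ψ c
        refute (ψ , c , c≼c′ , va , unav) =
          T.not-both-unavoidable (≼-trans c≼c′ c′≼p) va unav c′≼p va′ unav′ c≼c′

-- The generic coloring

elt-injective : ∀ s n {t m} → elt s n ≡ elt t m → s ≡ t × n ≡ m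
elt-injective false zero {false} {zero} _ = refl , refl
elt-injective false (suc n) {false} {suc m} eq
  with refl , refl ← elt-injective false n {false} {m} (suc-injective (suc-injective eq)) = refl , refl
elt-injective false (suc n) {true} {suc m} eq
  with () , _ ← elt-injective false n {true} {m} (suc-injective (suc-injective eq))
elt-injective true zero {true} {zero} _ = refl , refl
elt-injective true (suc n) {true} {suc m} eq
  with refl , refl ← elt-injective true n {true} {m} (suc-injective (suc-injective eq)) = refl , refl
elt-injective true (suc n) {false} {suc m} eq
  with () , _ ← elt-injective true n {false} {m} (suc-injective (suc-injective eq))
elt-injective false (suc n) {true} {zero} ()
elt-injective true (suc n) {true} {zero} ()
elt-injective true zero {true} {suc m} ()
elt-injective true zero {false} {suc m} ()

elt-surjective : ∀ k → Σ Bool λ s → Σ ℕ λ n → n ≤ k × elt s n ≡ k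
elt-surjective zero = false , 0 , z≤n , refl
elt-surjective (suc zero) = true , 0 , z≤n , refl
elt-surjective (suc (suc k)) with elt-surjective k
... | false , n , le , refl = false , suc n , s≤s (m≤n⇒m≤1+n le) , refl
... | true  , n , le , refl = true  , suc n , s≤s (m≤n⇒m≤1+n le) , refl

-- The larger of the two elements was added later, and at that moment its column was forced on the
-- opposite side.
pair-force : ∀ {e i p F a b} → Valid e i p F → (false , a) ∈ F → (true , b) ∈ F →
  (a < b × Forces e p a b i) ⊎ (b < a × Forces e p b a i)
pair-force {e} {F = _ ∷ _} (valid so (_ , fo) _) (here refl) (there b∈) =
  inj₂ (<-≤-trans (Sorted-bound (proj₁ so) b∈) (proj₂ so) , fo b∈ λ ())
pair-force {e} {F = _ ∷ _} (valid so (_ , fo) _) (there a∈) (here refl) =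
  inj₁ (<-≤-trans (Sorted-bound (proj₁ so) a∈) (proj₂ so) , fo a∈ λ ())
pair-force {e} {F = _ ∷ _} va (there a∈) (there b∈) = pair-force (Valid-tail e va) a∈ b∈

col-< : ∀ f {x y} → x < y → col f x y ≡ f x y
col-< f {x} {y} x<y with x <ᵇ y | <⇒<ᵇ x<y
... | true | _ = refl

col-> : ∀ f {x y} → y < x → col f x y ≡ f y x
col-> f {x} {y} y<x with x <ᵇ y in eq
... | false = refl
... | true = ⊥-elim (<-asym y<x (<ᵇ⇒< x y (subst T (sym eq) tt)))

-- The construction in stages

data State : Set where
  idle : State
  run  : Bool → Subset → Approx → (Approx → ℕ) → State

data _⊒_ : State → State → Set where
  idle⊒ : ∀ {st} → idle ⊒ st
  run⊒  : ∀ {i X F K F′ K′} → (∀ G → K G ≤ K′ G) → Ext X K F F′ → run i X F K ⊒ run i X F′ K′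

⊒-refl : ∀ {st} → st ⊒ st
⊒-refl {idle} = idle⊒
⊒-refl {run _ _ _ _} = run⊒ (λ _ → ≤-refl) done

⊒-trans : ∀ {st st′ st″} → st ⊒ st′ → st′ ⊒ st″ → st ⊒ st″
⊒-trans idle⊒ _ = idle⊒
⊒-trans (run⊒ k E) (run⊒ k′ E′) =
  run⊒ (λ G → ≤-trans (k G) (k′ G)) (Ext-trans E (Ext-mono k E′))

module Final (em : ExcludedMiddle 0ℓ) where
  open Classical em
  open Core em
  open Existence em

  Inv : PR 2 → Cond → State → Set
  Inv e p idle = ⊤
  Inv e p (run i X F K) = Valid e i p F × Runnable e i X p

  Inv-mono : ∀ {e p q} st → q ≼ p → Inv e p st → Inv e q st
  Inv-mono idle _ _ = tt
  Inv-mono {e} (run i X F K) q≼p (va , ru) = Valid-mono e q≼p va , Runnable-mono q≼p ru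

  record Global : Set where
    field
      cur : Cond
      state : PR 2 → State
      inv : ∀ e → Inv e cur (state e)
  open Global

  record _⊴_ (h g : Global) : Set where
    field
      cur≼ : cur h ≼ cur g
      state⊒ : ∀ e → state g e ⊒ state h e
  open _⊴_

  ⊴-refl : ∀ {g} → g ⊴ g
  ⊴-refl = record { cur≼ = ≼-refl ; state⊒ = λ _ → ⊒-refl }

  ⊴-trans : ∀ {k h g} → k ⊴ h → h ⊴ g → k ⊴ g
  ⊴-trans k⊴h h⊴g = record
    { cur≼ = ≼-trans (cur≼ k⊴h) (cur≼ h⊴g) ; state⊒ = λ e → ⊒-trans (state⊒ h⊴g e) (state⊒ k⊴h e) }

  move : ∀ g q → q ≼ cur g → Σ Global λ h → h ⊴ g × cur h ≡ q
  move g q q≼ = record { cur = q ; state = state g ; inv = λ e → Inv-mono (state g e) q≼ (inv g e) } ,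
    record { cur≼ = q≼ ; state⊒ = λ _ → ⊒-refl } , refl

  update : ∀ g e q st → q ≼ cur g → Inv e q st → state g e ⊒ st →
    Σ Global λ h → h ⊴ g × cur h ≡ q × state h e ≡ st
  update g e q st q≼ iv le = h , record { cur≼ = q≼ ; state⊒ = λ e′ → above e′ em } , refl , at em
    where
    at′ : ∀ e′ → Dec (e′ ≡ e) → State
    at′ e′ d = choose d st (state g e′)
    invariant : ∀ e′ (d : Dec (e′ ≡ e)) → Inv e′ q (at′ e′ d)
    invariant e′ (yes refl) = iv
    invariant e′ (no _) = Inv-mono (state g e′) q≼ (inv g e′)
    above : ∀ e′ (d : Dec (e′ ≡ e)) → state g e′ ⊒ at′ e′ d
    above e′ (yes refl) = le
    above e′ (no _) = ⊒-refl
    at : (d : Dec (e ≡ e)) → at′ e d ≡ st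
    at d = choose-yes d refl
    h : Global
    h = record { cur = q ; state = λ e′ → at′ e′ em ; inv = λ e′ → invariant e′ em }

  -- Along the generic sequence, the first alternative makes Φ_e(f) partial and the second makes it
  -- unstable; see `not-dead`.
  Dead : PR 2 → Cond → Set
  Dead e p = (Σ ℕ λ x → Σ ℕ λ y → ∀ r → r ≼ p → ∀ v → ¬ Forces e r x y v) ⊎
             (Σ ℕ λ x → ∀ r → r ≼ p → ∀ b → ¬ Decides e r x b)

  record Running (e : PR 2) (g : Global) : Set where
    constructor running
    field
      {colour} : Bool
      {pool} : Subset
      {part} : Approx
      {bounds} : Approx → ℕ
      state≡ : state g e ≡ run colour pool part bounds
    now-at : Mathias
    now-at = mathias (cur g) part bounds
    invariant : Valid e colour (cur g) part × Runnable e colour pool (cur g)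
    invariant = subst (Inv e (cur g)) state≡ (inv g e)
  open Running

  convergent-or-dead : ∀ e p → Convergent e p ⊎ Σ Cond λ q → q ≼ p × Dead e q
  convergent-or-dead e p with em {Convergent e p}
  ... | yes conv = inj₁ conv
  ... | no ¬conv = inj₂ (dne λ none → ¬conv λ q q≼p x y → dne λ never →
    none (q , q≼p , inj₁ (x , y , λ r r≼q v fo → never (r , r≼q , v , fo))))

  deciding-or-dead : ∀ e p → Deciding e p ⊎ Σ Cond λ q → q ≼ p × Dead e q
  deciding-or-dead e p with em {Deciding e p}
  ... | yes deci = inj₁ deci
  ... | no ¬deci = inj₂ (dne λ none → ¬deci λ q q≼p x → dne λ never →
    none (q , q≼p , inj₂ (x , λ r r≼q b de → never (r , r≼q , b , de))))

  start : ∀ e g → Σ Global λ h → h ⊴ g × (Dead e (cur h) ⊎ Running e h)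
  start e g = from (state g e) refl
    where
    Goal : Set
    Goal = Σ Global λ h → h ⊴ g × (Dead e (cur h) ⊎ Running e h)
    kill : (Σ Cond λ q → q ≼ cur g × Dead e q) → Goal
    kill (q , q≼ , dead) with move g q q≼
    ... | h , h⊴g , refl = h , h⊴g , inj₁ dead
    begin-run : state g e ≡ idle →
      (Σ Cond λ q → q ≼ cur g × Σ Bool λ i → Σ Subset λ X → Runnable e i X q) → Goal
    begin-run eq (q , q≼ , i , X , ru)
      with update g e q (run i X [] (λ _ → 0)) q≼ (valid tt tt (λ ()) , ru)
             (subst (_⊒ run i X [] (λ _ → 0)) (sym eq) idle⊒)
    ... | h , h⊴g , _ , eq′ = h , h⊴g , inj₂ (running eq′)
    from : ∀ st → state g e ≡ st → Goal
    from (run _ _ _ _) eq = g , ⊴-refl , inj₂ (running eq)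
    from idle eq with convergent-or-dead e (cur g) | deciding-or-dead e (cur g)
    ... | inj₂ dead | _ = kill dead
    ... | inj₁ _ | inj₂ dead = kill dead
    ... | inj₁ conv | inj₁ deci = begin-run eq (runnable-exists e (cur g) conv deci)

  advance : ∀ {e g} (ru : Running e g) d → pool ru ⊢ d ⊑ now-at ru →
    Valid e (colour ru) (cnd d) (fin d) →
    Σ Global λ h → h ⊴ g × cur h ≡ cnd d × state h e ≡ run (colour ru) (pool ru) (fin d) (bnd d)
  advance {e} {g} ru d (ext p k E) va =
    update g e (cnd d) (run (colour ru) (pool ru) (fin d) (bnd d)) p
      (va , Runnable-mono p (proj₂ (invariant ru)))
      (subst (_⊒ run (colour ru) (pool ru) (fin d) (bnd d)) (sym (state≡ ru)) (run⊒ k E))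

  -- The tasks `oscillate` concern functionals with an undecidable limit: together they make
  -- Φ_e(f)(x, ·) take both values infinitely often.
  Task : Set
  Task = ℕ ⊎ (PR 2 × ℕ × Bool × ℕ) ⊎ (PR 2 × PR 1) ⊎ (PR 2 × Bool × ℕ)

  pattern grow N = inj₁ N
  pattern oscillate e x v N = inj₂ (inj₁ (e , x , v , N))
  pattern avoid e ψ = inj₂ (inj₂ (inj₁ (e , ψ)))
  pattern put e s N = inj₂ (inj₂ (inj₂ (e , s , N)))

  coded-Task : Coded Task
  coded-Task = coded-⊎ coded-ℕ (coded-⊎
    (coded-× (coded-PR 2) (coded-× coded-ℕ (coded-× coded-Bool coded-ℕ)))
    (coded-⊎ (coded-× (coded-PR 2) (coded-PR 1)) (coded-× (coded-PR 2) (coded-× coded-Bool coded-ℕ))))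

  Met : Task → Global → Set
  Met (grow N) g = N ≤ len (cur g)
  Met (oscillate e x v N) g =
    (Σ ℕ λ y → N ≤ y × Forces e (cur g) x y v) ⊎
    (∀ r → r ≼ cur g → ∀ y → N ≤ y → ¬ Forces e r x y v)
  Met (avoid e ψ) g = Dead e (cur g) ⊎ Σ (Running e g) λ ru → Avoids ψ e (colour ru) (pool ru) (now-at ru)
  Met (put e s N) g = Dead e (cur g) ⊎ Σ (Running e g) λ ru → Σ ℕ λ y → N ≤ y × (s , y) ∈ part ru

  meet : ∀ t g → Σ Global λ h → h ⊴ g × Met t h
  meet (grow N) g with move g (extend (cur g) N (λ _ → true)) (extend-≼ (cur g) N (λ _ → true))
  ... | h , h⊴g , refl = h , h⊴g , extend-len (cur g) N (λ _ → true)
  meet (oscillate e x v N) g with em {Σ Cond λ r → r ≼ cur g × Σ ℕ λ y → N ≤ y × Forces e r x y v}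
  ... | no none = g , ⊴-refl , inj₂ λ r r≼ y le fo → none (r , r≼ , y , le , fo)
  ... | yes (r , r≼ , y , le , fo) with move g r r≼
  ... | h , h⊴g , refl = h , h⊴g , inj₁ (y , le , fo)
  meet (avoid e ψ) g with start e g
  ... | h , h⊴g , inj₁ dead = h , h⊴g , inj₁ dead
  ... | h , h⊴g , inj₂ ru with invariant ru
  ... | va , rb with avoidable rb (ψ , now-at ru) (≼-refl , va)
  ... | d , d⊑ , va′ , av with advance ru d d⊑ va′
  ... | k , k⊴h , refl , eq = k , ⊴-trans k⊴h h⊴g , inj₂ (running eq , av)
  meet (put e s N) g with start e g
  ... | h , h⊴g , inj₁ dead = h , h⊴g , inj₁ dead
  ... | h , h⊴g , inj₂ ru with invariant ru
  ... | va , rb = place (C.rich-sequence ≼-refl (λ k → proj₁ (infinite rb k))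
      (λ k → proj₁ (proj₂ (infinite rb k))) (λ k → proj₂ (proj₂ (infinite rb k))) M)
    where
    module C = Colour e (pool ru) (cur h) (convergence rb) (decision rb) (colour ru) (richness rb)
    M : ℕ
    M = (N ⊔ bounds ru (part ru)) ⊔ (len (cur h) ⊔ bound (part ru))
    place : (Σ ℕ λ k → M ≤ k × Σ Cond λ r → r ≼ cur h × Decides e r (proj₁ (infinite rb k)) (colour ru)) →
      Σ Global λ k → k ⊴ g × Met (put e s N) k
    place (k , M≤k , r , r≼ , de) = add-y (C.add-element s ≼-refl va
        (proj₁ (⊔-≤ (proj₂ (⊔-≤ {N ⊔ bounds ru (part ru)} M≤y))))
        (proj₂ (⊔-≤ {len (cur h)} (proj₂ (⊔-≤ {N ⊔ bounds ru (part ru)} M≤y)))) r≼ de)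
      where
      y : ℕ
      y = proj₁ (infinite rb k)
      M≤y : M ≤ y
      M≤y = ≤-trans M≤k (proj₁ (proj₂ (infinite rb k)))
      add-y : Σ Cond (λ r′ → r′ ≼ r × Valid e (colour ru) r′ ((s , y) ∷ part ru)) →
        Σ Global λ k → k ⊴ g × Met (put e s N) k
      add-y (r′ , r′≼r , va′)
        with advance ru (mathias r′ ((s , y) ∷ part ru) (bounds ru))
               (ext (≼-trans r′≼r r≼) (λ _ → ≤-refl) (add done (proj₂ (proj₂ (infinite rb k)))
                 (proj₂ (⊔-≤ {N} (proj₁ (⊔-≤ M≤y)))))) va′
      ... | g′ , g′⊴h , _ , eq = g′ , ⊴-trans g′⊴h h⊴g ,
            inj₂ (running eq , y , proj₁ (⊔-≤ (proj₁ (⊔-≤ M≤y))) , here refl)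

  module Sequence where

    task : ℕ → Task
    task = proj₁ (coded-countable coded-Task)

    sequence : ℕ → Global
    sequence zero = record
      { cur = cond 0 (λ _ _ → true) (λ _ → true) ; state = λ _ → idle ; inv = λ _ → tt }
    sequence (suc n) = proj₁ (meet (task n) (sequence n))

    decreasing : ∀ {m n} → m ≤ n → sequence n ⊴ sequence m
    decreasing {n = zero} z≤n = ⊴-refl
    decreasing {m} {suc n} m≤sn with m≤n⇒m<n∨m≡n m≤sn
    ... | inj₁ m<sn = ⊴-trans (proj₁ (proj₂ (meet (task n) (sequence n)))) (decreasing (≤-pred m<sn))
    ... | inj₂ refl = ⊴-refl

    meets : ∀ t → (Σ ℕ λ n → task n ≡ t) → Σ ℕ λ n → Met t (sequence n)
    meets t (n , refl) = suc n , proj₂ (proj₂ (meet (task n) (sequence n)))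

  -- Opaque, since unfolding the enumeration of tasks is expensive.
  abstract
    generic : Σ (ℕ → Global) λ g → (∀ {m n} → m ≤ n → g n ⊴ g m) × (∀ t → Σ ℕ λ n → Met t (g n))
    generic = sequence , decreasing , λ t → meets t (proj₂ (coded-countable coded-Task) t)
      where open Sequence

  stage : ℕ → Global
  stage = proj₁ generic

  descending : ∀ {m n} → m ≤ n → stage n ⊴ stage m
  descending = proj₁ (proj₂ generic)

  met : ∀ t → Σ ℕ λ n → Met t (stage n)
  met = proj₂ (proj₂ generic)

  condition : ℕ → Cond
  condition n = cur (stage n)

  condition-≼ : ∀ {m n} → m ≤ n → condition n ≼ condition m
  condition-≼ m≤n = cur≼ (descending m≤n)

  long : ℕ → ℕ
  long N = proj₁ (met (grow N))

  long-len : ∀ N → N ≤ len (condition (long N))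
  long-len N = proj₂ (met (grow N))

  f : Coloring
  f x y = val (condition (long (suc (x ⊔ y)))) x y

  f-val : ∀ n {x y} → x < len (condition n) → y < len (condition n) → f x y ≡ val (condition n) x y
  f-val n {x} {y} x< y< = by (≤-total n m)
    where
    m : ℕ
    m = long (suc (x ⊔ y))
    by : n ≤ m ⊎ m ≤ n → f x y ≡ val (condition n) x y
    by (inj₁ n≤m) = val≡ (condition-≼ n≤m) x< y<
    by (inj₂ m≤n) = sym (val≡ (condition-≼ m≤n) (≤-trans (s≤s (m≤m⊔n x y)) (long-len (suc (x ⊔ y))))
                                          (≤-trans (s≤s (m≤n⊔m x y)) (long-len (suc (x ⊔ y)))))

  f-lim : ∀ n {x y} → x < len (condition n) → len (condition n) ≤ y → f x y ≡ lim (condition n) x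
  f-lim n {x} {y} x< ≤y = by (≤-total n m)
    where
    m : ℕ
    m = long (suc (x ⊔ y))
    y<m : y < len (condition m)
    y<m = ≤-trans (s≤s (m≤n⊔m x y)) (long-len (suc (x ⊔ y)))
    by : n ≤ m ⊎ m ≤ n → f x y ≡ lim (condition n) x
    by (inj₁ n≤m) = new (condition-≼ n≤m) x< ≤y y<m
    by (inj₂ m≤n) = ⊥-elim (<⇒≱ (<-≤-trans y<m (len≤ (condition-≼ m≤n))) ≤y)

  f-stable : Stable f
  f-stable x = lim (condition n) x , len (condition n) , λ u le _ → f-lim n (long-len (suc x)) le
    where
    n : ℕ
    n = long (suc x)

  -- The p-homogeneous set for a given functional

  module Solution (fh : Coloring) (fh-stable : Stable fh) (e : PR 2)
    (computes : ∀ x y → Eval (colOracle f) e (x ∷ y ∷ []) (bit (fh x y))) where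

    forced : ∀ n {x y v} → Forces e (condition n) x y v → fh x y ≡ v
    forced n {x} {y} fo = bit-injective (eval-det (computes x y) (fo f (f-val n)))

    eventually-forced : ∀ x y → Σ ℕ λ m → ∀ n → m ≤ n → Forces e (condition n) x y (fh x y)
    eventually-forced x y with eval-local (computes x y)
    ... | b , local = long b , λ n m≤n g ag → local (colOracle g) λ a c a<b c<b →
      let up = ≤-trans (long-len b) (len≤ (condition-≼ m≤n)) in
      cong bit (trans (f-val n (<-≤-trans a<b up) (<-≤-trans c<b up))
                      (sym (ag (<-≤-trans a<b up) (<-≤-trans c<b up))))

    -- If the task `oscillate` ended with `v` unattainable from `N` on, then a later condition
    -- longer than `N` would decide the limit to be `not v`.
    recurs : ∀ n {x} → (∀ r → r ≼ condition n → ∀ b → ¬ Decides e r x b) →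
      ∀ v N → Σ ℕ λ y → N ≤ y × fh x y ≡ v
    recurs n {x} undecided v N with met (oscillate e x v N)
    ... | m , inj₁ (y , N≤y , fo) = y , N≤y , forced m fo
    ... | m , inj₂ never = ⊥-elim (undecided (condition k) (condition-≼ n≤k) (not v) λ q y b q≼ k≤y fo →
        ¬-not λ { refl → never q (≼-trans q≼ (condition-≼ m≤k)) y
          (≤-trans (long-len N) (≤-trans (len≤ (condition-≼ l≤k)) k≤y)) fo })
      where
      k : ℕ
      k = (n ⊔ m) ⊔ long N
      n≤k : n ≤ k
      n≤k = ≤-trans (m≤m⊔n n m) (m≤m⊔n _ _)
      m≤k : m ≤ k
      m≤k = ≤-trans (m≤n⊔m n m) (m≤m⊔n _ _)
      l≤k : long N ≤ k
      l≤k = m≤n⊔m _ _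

    not-dead : ∀ n → ¬ Dead e (condition n)
    not-dead n (inj₁ (x , y , never)) with eventually-forced x y
    ... | m , fo = never (condition (n ⊔ m)) (condition-≼ (m≤m⊔n n m)) (fh x y) (fo (n ⊔ m) (m≤n⊔m n m))
    not-dead n (inj₂ (x , undecided)) with fh-stable x
    ... | c , N , stable with recurs n undecided (not c) (N ⊔ suc x)
    ... | y , le , eq = not≢ c (trans (sym eq) (stable y (proj₁ (⊔-≤ le)) (proj₂ (⊔-≤ {N} le))))

    first : Σ ℕ λ n → Running e (stage n)
    first with met (put e true 0)
    ... | n , inj₁ dead = ⊥-elim (not-dead n dead)
    ... | n , inj₂ (ru , _) = n , ru

    n₀ : ℕ
    n₀ = proj₁ first

    i : Bool
    i = colour (proj₂ first)

    X : Subset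
    X = pool (proj₂ first)

    persists : ∀ {m n i′ X′ F K} → m ≤ n → state (stage m) e ≡ run i′ X′ F K →
      Σ Approx λ F′ → Σ (Approx → ℕ) λ K′ → state (stage n) e ≡ run i′ X′ F′ K′ ×
      (∀ G → K G ≤ K′ G) × Ext X′ K F F′
    persists {m} {n} m≤n eq with state (stage m) e | state (stage n) e | state⊒ (descending m≤n) e
    persists m≤n refl | _ | _ | run⊒ k E = _ , _ , refl , k , E

    members : State → Approx
    members idle = []
    members (run _ _ F _) = F

    approx : ℕ → Approx
    approx n = members (state (stage n) e)

    caps : State → Approx → ℕ
    caps idle _ = 0
    caps (run _ _ _ K) = K

    cap : ℕ → Approx → ℕ
    cap n = caps (state (stage n) e)

    state-run : ∀ n → n₀ ≤ n → state (stage n) e ≡ run i X (approx n) (cap n)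
    state-run n n₀≤n with persists n₀≤n (state≡ (proj₂ first))
    ... | F , K , eq , _ = trans eq (cong₂ (run i X) (sym (cong members eq)) (sym (cong caps eq)))

    approx-valid : ∀ n → n₀ ≤ n → Valid e i (condition n) (approx n)
    approx-valid n n₀≤n = proj₁ (subst (Inv e (condition n)) (state-run n n₀≤n) (inv (stage n) e))

    later : ∀ {m n} → n₀ ≤ m → m ≤ n →
      X ⊢ mathias (condition n) (approx n) (cap n) ⊑ mathias (condition m) (approx m) (cap m)
    later {m} {n} n₀≤m m≤n with persists m≤n (state-run m n₀≤m)
    ... | F , K , eq , k , E rewrite eq = ext (condition-≼ m≤n) k E

    Hit : ℕ → Set
    Hit k = Σ ℕ λ n → n₀ ≤ n × Σ Bool λ s → Σ ℕ λ y → (s , y) ∈ approx n × k ≡ elt s y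

    Hh : Subset
    Hh = ⟦ Hit ⟧

    Hh-intro : ∀ {n s y} → n₀ ≤ n → (s , y) ∈ approx n → Hh (elt s y) ≡ true
    Hh-intro {n} {s} {y} n₀≤n u∈ = ⟦⟧-intro Hit (n , n₀≤n , s , y , u∈ , refl)

    Hh-elim : ∀ {s y} → Hh (elt s y) ≡ true → Σ ℕ λ n → n₀ ≤ n × (s , y) ∈ approx n
    Hh-elim {s} {y} inH with ⟦⟧-elim Hit inH
    ... | n , n₀≤n , t , z , u∈ , eq with refl , refl ← elt-injective s y {t} {z} eq = n , n₀≤n , u∈

    Hh-extends : ∀ n → n₀ ≤ n → Hh Extends approx n
    Hh-extends n n₀≤n s y y< = to , Hh-intro n₀≤n
      where
      to : Hh (elt s y) ≡ true → (s , y) ∈ approx n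
      to inH with Hh-elim {s} {y} inH
      ... | m , n₀≤m , u∈ with ≤-total m n
      ... | inj₁ m≤n = Ext-∈ (fin-ext (later n₀≤m m≤n)) u∈
      ... | inj₂ n≤m = Ext-below (fin-ext (later n₀≤n n≤m)) (sorted (approx-valid m n₀≤m)) u∈ y<

    placed : ∀ s N → Σ ℕ λ n → n₀ ≤ n × Σ ℕ λ y → N ≤ y × (s , y) ∈ approx n
    placed s N with met (put e s N)
    ... | m , inj₁ dead = ⊥-elim (not-dead m dead)
    ... | m , inj₂ (ru , y , N≤y , u∈) with persists (m≤m⊔n m n₀) (state≡ ru)
    ... | F , K , eq , _ , E = m ⊔ n₀ , m≤n⊔m m n₀ , y , N≤y ,
      subst ((s , y) ∈_) (sym (cong members eq)) (Ext-∈ E u∈)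

    avoided : ∀ ψ → Σ ℕ λ n → n₀ ≤ n × Avoids ψ e i X (mathias (condition n) (approx n) (cap n))
    avoided ψ with met (avoid e ψ)
    ... | m , inj₁ dead = ⊥-elim (not-dead m dead)
    ... | m , inj₂ (running eq , av) with persists (m≤m⊔n m n₀) eq
    ... | F , K , eq′ , k , E with trans (sym eq′) (state-run (m ⊔ n₀) (m≤n⊔m m n₀))
    ... | refl = m ⊔ n₀ , m≤n⊔m m n₀ ,
      Avoids-mono ψ e i X (ext (condition-≼ (m≤m⊔n m n₀)) k E)
        (sorted (approx-valid (m ⊔ n₀) (m≤n⊔m m n₀))) av

    Hh-homogeneous : PHomogeneous fh Hh
    Hh-homogeneous = side false , side true , i , cross
      where
      side : ∀ s N → Σ ℕ λ y → N ≤ y × Hh (elt s y) ≡ true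
      side s N with placed s N
      ... | n , n₀≤n , y , N≤y , u∈ = y , N≤y , Hh-intro n₀≤n u∈
      cross : ∀ x y → x ≢ y → Hh (elt false x) ≡ true → Hh (elt true y) ≡ true → col fh x y ≡ i
      cross x y _ inL inR with Hh-elim {false} {x} inL | Hh-elim {true} {y} inR
      ... | m , n₀≤m , x∈ | n , n₀≤n , y∈
        with pair-force (approx-valid (m ⊔ n) (≤-trans n₀≤m (m≤m⊔n m n)))
               (Ext-∈ (fin-ext (later n₀≤m (m≤m⊔n m n))) x∈)
               (Ext-∈ (fin-ext (later n₀≤n (m≤n⊔m m n))) y∈)
      ... | inj₁ (x<y , fo) = trans (col-< fh x<y) (forced (m ⊔ n) fo)
      ... | inj₂ (y<x , fo) = trans (col-> fh y<x) (forced (m ⊔ n) fo)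

    computes-nothing : ∀ H → Homogeneous f H → ¬ ComputesSet (setOracle Hh) H
    computes-nothing H (H-inf , c , hom) (ψ , comp-H) = refute (avoided ψ)
      where
      out-∈ : ∀ {n x} → n₀ ≤ n → Out ψ (approx n) x → H x ≡ true
      out-∈ {n} {x} n₀≤n out = bit-injective (eval-det (comp-H x) (out Hh (Hh-extends n n₀≤n)))
      limit : ∀ n {x} → H x ≡ true → x < len (condition n) → lim (condition n) x ≡ c
      limit n {x} inH x< with H-inf (len (condition n))
      ... | u , le , inH′ = trans (sym (f-lim n x< le)) (hom x u (<-≤-trans x< le) inH inH′)
      refute : ¬ Σ ℕ λ n → n₀ ≤ n × Avoids ψ e i X (mathias (condition n) (approx n) (cap n))
      refute (n , n₀≤n , inj₁ (x , x′ , o , o′ , x< , x′< , inj₁ ne)) =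
        ne (trans (limit n (out-∈ n₀≤n o) x<) (sym (limit n (out-∈ n₀≤n o′) x′<)))
      refute (n , n₀≤n , inj₁ (x , x′ , o , o′ , x< , x′< , inj₂ (x<x′ , ne))) =
        ne (trans (sym (f-val n x< x′<)) (trans (hom x x′ x<x′ (out-∈ n₀≤n o) (out-∈ n₀≤n o′))
                                                (sym (limit n (out-∈ n₀≤n o) x<))))
      refute (n , n₀≤n , inj₂ (m , quiet)) with H-inf m
      ... | x , m≤x , inH
        with b , local ← eval-local (subst (Eval (setOracle Hh) ψ (x ∷ [])) (cong bit inH) (comp-H x))
        -- An element above the use `b` pushes `bound` beyond `b` for both sides, so the
        -- approximation alone already yields the computation.
        with k , n₀≤k , y , b≤y , y∈ ← placed false b =
        quiet (condition (n ⊔ k)) (approx (n ⊔ k)) (condition-≼ (m≤m⊔n n k))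
          (fin-ext (later n₀≤n (m≤m⊔n n k))) va x m≤x out
        where
        va : Valid e i (condition (n ⊔ k)) (approx (n ⊔ k))
        va = approx-valid (n ⊔ k) (≤-trans n₀≤n (m≤m⊔n n k))
        y< : y < bound (approx (n ⊔ k))
        y< = Sorted-bound (sorted va) (Ext-∈ (fin-ext (later n₀≤k (m≤n⊔m n k))) y∈)
        same : ∀ {A B : Bool} {Q : Set} → (A ≡ true → Q) × (Q → A ≡ true) →
          (B ≡ true → Q) × (Q → B ≡ true) → A ≡ B
        same {false} {false} _ _ = refl
        same {true}  {true}  _ _ = refl
        same {false} {true} (_ , from) (to , _) = from (to refl)
        same {true} {false} (to , _) (_ , from) = sym (from (to refl))
        out : Out ψ (approx (n ⊔ k)) x
        out G G-ext = local (setOracle G) λ a _ a<b _ → cong bit (agree a a<b)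
          where
          agree : ∀ a → a < b → Hh a ≡ G a
          agree a a<b with elt-surjective a
          ... | s , z , z≤a , refl =
            same (Hh-extends (n ⊔ k) (≤-trans n₀≤n (m≤m⊔n n k)) s z z<) (G-ext s z z<)
            where
            z< : z < bound (approx (n ⊔ k))
            z< = ≤-<-trans (≤-trans z≤a (≤-trans (<⇒≤ a<b) b≤y)) y<

theorem1p8 : ExcludedMiddle 0ℓ →
    Σ Coloring λ f → Stable f ×
    ((fh : Coloring) → Stable fh → ComputesColoring (colOracle f) fh →
    Σ Subset λ Hh → PHomogeneous fh Hh ×
    ((H : Subset) → Homogeneous f H → ¬ ComputesSet (setOracle Hh) H))
theorem1p8 em = f , f-stable , λ fh stable (e , computes) →
  Solution.Hh fh stable e computes , Solution.Hh-homogeneous fh stable e computes ,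
  Solution.computes-nothing fh stable e computes
  where open Final em
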